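{- Let $M\geq 1$ be an integer and let $(\tau,R)$ be an $M$-layer medium, with $\tau=(\tau_0,\ldots,\tau_M)$ and $R=(R_0,\ldots,R_M)$. Then \[ G^{(\tau,R)}(t)=\sum_{k\in\mathfrak{L}_M}a(R,k)\,\delta(t-\langle k,\tau\rangle), \] where for each $k\in\mathfrak{L}_M$, setting $u=\min\{\mathbb{1},\tilde{k}\}$, \[ a(R,k)=\sum_{b\in V(k)}\binom{k}{b}\binom{\tilde{k}-u}{b-u}(-R)^{\tilde{k}-b}R^{k-b}T^{2b}, \] and $V(k)$ denotes the set of $b\in\mathbb{Z}^{M+1}$ such that $u\leq b\leq\min\{k,\tilde{k}\}$.
   Context: Fix depths $z_{ -1}<z_0<z_1<\cdots<z_M$. An $M$-layer medium is a pair $(\tau,R)$ with $\tau=(\tau_0,\ldots,\tau_M)$ positive reals (two-way travel times; $\tau_j/2$ is the time to traverse between $z_{j-1}$ and $z_j$) and $R=(R_0,\ldots,R_M)$ reals with $-1<R_n<1$ (reflection coefficients at $z_n$). Set $T_n=\sqrt{1-R_n^2}$ and $T=(T_0,\ldots,T_M)$. A (reflection) scattering sequence is a finite sequence $\mathsf{p}=(\mathsf{p}_0,\ldots,\mathsf{p}_L)$ with $L\geq 2$, $\mathsf{p}_0=\mathsf{p}_L=z_{ -1}$, $\mathsf{p}_i\in\{z_0,\ldots,z_M\}$ for $1\le i\le L-1$, and for every $0\le i\le L-1$ there is $-1\le j\le M-1$ with $\{\mathsf{p}_i,\mathsf{p}_{i+1}\}=\{z_j,z_{j+1}\}$. Let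 $\mathsf{S}_M$ be the set of these. The weight of $\mathsf{p}$ is $w(\mathsf{p})=\prod_{i=1}^{L-1}w_i$, where if $\mathsf{p}_i=z_j$: $w_i=R_j$ if $\mathsf{p}_{i-1}=\mathsf{p}_{i+1}=z_{j-1}$; $w_i=-R_j$ if $\mathsf{p}_{i-1}=\mathsf{p}_{i+1}=z_{j+1}$; $w_i=T_j$ otherwise. The arrival time of $\mathsf{p}$ is $\sigma(\mathsf{p})=\sum_{i=0}^{L-1}\tau_{j_i}/2$, where step $i$ goes between $z_{j_i-1}$ and $z_{j_i}$ ($0\le j_i\le M$). The reflection Green's function (velocity impulse response recorded at $z_{ -1}$ for a downward unit plane-wave impulse started at $z_{ -1}$) is $G^{(\tau,R)}(t)=\sum_{\mathsf{p}\in\mathsf{S}_M}w(\mathsf{p})\,\delta(t-\sigma(\mathsf{p}))$, terms with equal arrival times being combined. $\mathfrak{L}_M=\{(k_0,\ldots,k_M)\in\mathbb{Z}_{\ge 0}^{M+1}: k_0=1\text{ and for all }n\le M-1,\ k_n=0\Rightarrow k_{n+1}=0\}$. Vector conventions: for $k=(k_0,\ldots,k_M)$, $\tilde{k}=(k_1,\ldots,k_M,0)$; $\mathbb{1}=(1,\ldots,1)\in\mathbb{Z}^{M+1}$; $\min$ and $\le$ are entrywise; $\langle k,\tau\rangle=\sum_n k_n\tau_n$; $s^d=\prod_{n=0}^M s_n^{d_n}$ (with $0^0=1$); $\binom{x}{y}=\prod_{n=0}^M\binom{x_n}{y_n}$. -}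

module Defs where

open import Level using (Level; _⊔_; 0ℓ) renaming (suc to lsuc)
open import Algebra.Bundles using (CommutativeRing; Semiring)
open import Algebra.Apartness.Bundles using (HeytingField; HeytingCommutativeRing)
import Algebra.Definitions.RawSemiring as RawSemiringOps
open import Data.Bool.Base using (if_then_else_)
open import Data.Fin.Base using (Fin; zero; suc; toℕ; inject₁)
open import Data.List.Base as List using (List; []; _∷_; _∷ʳ_)
open import Data.List.Membership.Propositional using (_∈_; _∉_)
open import Data.List.Membership.Propositional.Properties
  using (∈-map⁺; ∈-map⁻; ∈-upTo⁺; ∈-upTo⁻; ∈-cartesianProductWith⁺; ∈-cartesianProductWith⁻)
open import Data.List.Relation.Unary.AllPairs as AllPairs using ()
open import Data.List.Relation.Unary.All using (All; [])
open import Data.List.Relation.Unary.Any using (here)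
open import Data.List.Relation.Unary.Linked using (Linked)
open import Data.List.Relation.Unary.Unique.Propositional using (Unique)
import Data.List.Relation.Unary.Unique.Propositional.Properties as Uniqueₚ
open import Data.Nat.Base as ℕ using (ℕ; zero; suc; _∸_)
open import Data.Nat.Combinatorics using (_C_)
import Data.Nat.Properties as ℕₚ
open import Data.Product.Base using (Σ; ∃; ∃-syntax; _×_; _,_; proj₁; proj₂)
open import Data.Sum.Base using (_⊎_)
open import Data.Vec.Base as Vec using (Vec; []; _∷_; lookup; zipWith; replicate)
open import Data.Vec.Properties using (∷-injective)
open import Data.Vec.Relation.Binary.Pointwise.Inductive using (Pointwise; []; _∷_)
open import Function.Bundles using (_⇔_; mk⇔; module Equivalence)
open import Relation.Binary.Core using (Rel)
open import Relation.Binary.PropositionalEquality using (_≡_; _≢_; refl; subst)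
open import Relation.Binary.Structures using (IsStrictPartialOrder)
open import Relation.Nullary.Decidable using (Dec; does; _×-dec_)
open import Relation.Nullary.Negation using (¬_)

-- The real numbers, given by their axioms: a Cauchy-complete Archimedean
-- ordered field.  The axioms are the constructive ones (apartness rather than
-- trichotomy); every complete ordered field in the classical sense is a model.

record RealField (c ℓ₁ ℓ₂ ℓ₃ : Level) : Set (lsuc (c ⊔ ℓ₁ ⊔ ℓ₂ ⊔ ℓ₃)) where
  field
    heytingField : HeytingField c ℓ₁ ℓ₂

  open HeytingField heytingField public hiding (refl; sym; trans; reflexive)

  commutativeRing : CommutativeRing c ℓ₁
  commutativeRing = HeytingCommutativeRing.commutativeRing heytingCommutativeRing

  open CommutativeRing commutativeRing public using (semiring)
  open CommutativeRing commutativeRing public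
    using () renaming (refl to ≈-refl; sym to ≈-sym; trans to ≈-trans)
  open RawSemiringOps (Semiring.rawSemiring semiring) public using (_^_) renaming (_×_ to _·_)

  infix 4 _<_ _≤_

  field
    _<_                  : Rel Carrier ℓ₃
    isStrictPartialOrder : IsStrictPartialOrder _≈_ _<_
    #⇒<⊎>                : ∀ {x y} → x # y → x < y ⊎ y < x
    <⇒#                  : ∀ {x y} → x < y → x # y
    0<1                  : 0# < 1#
    +-monoʳ-<            : ∀ z {x y} → x < y → z + x < z + y
    *-pos                : ∀ {x y} → 0# < x → 0# < y → 0# < x * y
    archimedean          : ∀ x → ∃[ n ] x < n · 1#

  _≤_ : Rel Carrier ℓ₃
  x ≤ y = ¬ (y < x)

  Cauchy : (ℕ → Carrier) → Set (c ⊔ ℓ₃)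
  Cauchy s = ∀ ε → 0# < ε → ∃[ N ] (∀ m n → N ℕ.≤ m → N ℕ.≤ n → s m - s n < ε)

  _ConvergesTo_ : (ℕ → Carrier) → Carrier → Set (c ⊔ ℓ₃)
  s ConvergesTo l =
    ∀ ε → 0# < ε → ∃[ N ] (∀ n → N ℕ.≤ n → (s n - l < ε) × (l - s n < ε))

  field
    complete : ∀ s → Cauchy s → ∃[ l ] (s ConvergesTo l)

  0<2 : 0# < 1# + 1#
  0<2 = <-trans 0<1 (<-respˡ-≈ (+-identityʳ 1#) (+-monoʳ-< 1# 0<1))
    where open IsStrictPartialOrder isStrictPartialOrder
            using (<-respˡ-≈) renaming (trans to <-trans)

  private
    2-0-invertible = #⇒invertible (#-sym (<⇒# 0<2))

  ½ : Carrier
  ½ = proj₁ 2-0-invertible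

  ½+½≈1 : ½ + ½ ≈ 1#
  ½+½≈1 =
    ≈-trans (+-cong (≈-sym (*-identityʳ ½)) (≈-sym (*-identityʳ ½)))
    (≈-trans (≈-sym (distribˡ ½ 1# 1#))
    (≈-trans (*-congˡ (≈-sym (≈-trans (+-congˡ -0≈0) (+-identityʳ (1# + 1#)))))
             (proj₁ (proj₂ 2-0-invertible))))
    where
    -0≈0 : - 0# ≈ 0#
    -0≈0 = ≈-trans (≈-sym (+-identityˡ (- 0#))) (-‿inverseʳ 0#)

  IsSqrt : Carrier → Carrier → Set (ℓ₁ ⊔ ℓ₃)
  IsSqrt x y = (0# ≤ y) × (y * y ≈ x)

  ∑ : ∀ {i} {I : Set i} → List I → (I → Carrier) → Carrier
  ∑ xs f = List.foldr (λ x acc → f x + acc) 0# xs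

infix 4 _≤ᵛ_
_≤ᵛ_ : ∀ {n} → Rel (Vec ℕ n) 0ℓ
_≤ᵛ_ = Pointwise ℕ._≤_

-- k̃ = (k₁ , … , k_M , 0)
shift : ∀ {M} → Vec ℕ (suc M) → Vec ℕ (suc M)
shift (_ ∷ ks) = ks Vec.∷ʳ 0

minᵛ : ∀ {n} → Vec ℕ n → Vec ℕ n → Vec ℕ n
minᵛ = zipWith ℕ._⊓_

infixl 6 _∸ᵛ_
_∸ᵛ_ : ∀ {n} → Vec ℕ n → Vec ℕ n → Vec ℕ n
_∸ᵛ_ = zipWith _∸_

binomᵛ : ∀ {n} → Vec ℕ n → Vec ℕ n → ℕ
binomᵛ x y = Vec.foldr′ ℕ._*_ 1 (zipWith _C_ x y)

Is𝔏 : ∀ {M} → Vec ℕ (suc M) → Set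
Is𝔏 {M} k =
  (lookup k zero ≡ 1) ×
  (∀ (n : Fin M) → lookup k (inject₁ n) ≡ 0 → lookup k (suc n) ≡ 0)

interval : ℕ → ℕ → List ℕ
interval l h = List.map (l ℕ.+_) (List.upTo (suc h ∸ l))

box : ∀ {n} → Vec ℕ n → Vec ℕ n → List (Vec ℕ n)
box []       []       = [] ∷ []
box (l ∷ ls) (h ∷ hs) = List.cartesianProductWith _∷_ (interval l h) (box ls hs)

∈-interval⇔ : ∀ l h {b} → b ∈ interval l h ⇔ (l ℕ.≤ b × b ℕ.≤ h)
∈-interval⇔ l h {b} = mk⇔ to from
  where
  to : b ∈ interval l h → l ℕ.≤ b × b ℕ.≤ h
  to b∈ with ∈-map⁻ (l ℕ.+_) b∈
  ... | i , i∈ , refl = ℕₚ.m≤m+n l i , ℕ.s≤s⁻¹ (subst (ℕ._≤ suc h) (ℕₚ.+-suc l i) l+1+i≤1+h)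
    where
    i< = ∈-upTo⁻ i∈
    l≤ : l ℕ.≤ suc h
    l≤ = ℕₚ.<⇒≤ (ℕₚ.m∸n≢0⇒n<m λ eq → ℕₚ.n≮0 (subst (i ℕ.<_) eq i<))
    l+1+i≤1+h : l ℕ.+ suc i ℕ.≤ suc h
    l+1+i≤1+h = subst (l ℕ.+ suc i ℕ.≤_) (ℕₚ.m+[n∸m]≡n l≤) (ℕₚ.+-monoʳ-≤ l i<)

  from : l ℕ.≤ b × b ℕ.≤ h → b ∈ interval l h
  from (l≤b , b≤h) = subst (_∈ interval l h) (ℕₚ.m+[n∸m]≡n l≤b)
    (∈-map⁺ (l ℕ.+_) (∈-upTo⁺ (ℕₚ.∸-monoˡ-< (ℕ.s≤s b≤h) l≤b)))

∈-box⇔ : ∀ {n} (lo hi : Vec ℕ n) {b} → b ∈ box lo hi ⇔ (lo ≤ᵛ b × b ≤ᵛ hi)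
∈-box⇔ lo hi = mk⇔ (to lo hi) (from lo hi)
  where
  open Equivalence renaming (to to ⇒; from to ⇐)

  to : ∀ {n} (lo hi : Vec ℕ n) {b} → b ∈ box lo hi → lo ≤ᵛ b × b ≤ᵛ hi
  to []       []       {[]} _ = [] , []
  to (l ∷ ls) (h ∷ hs) b∈ with ∈-cartesianProductWith⁻ _∷_ (interval l h) (box ls hs) b∈
  ... | _ , _ , x∈ , xs∈ , refl with ⇒ (∈-interval⇔ l h) x∈ | to ls hs xs∈
  ...   | l≤x , x≤h | ls≤xs , xs≤hs = l≤x ∷ ls≤xs , x≤h ∷ xs≤hs

  from : ∀ {n} (lo hi : Vec ℕ n) {b} → lo ≤ᵛ b × b ≤ᵛ hi → b ∈ box lo hi
  from []       []       ([] , [])                 = here refl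
  from (l ∷ ls) (h ∷ hs) (l≤ ∷ ls≤ , ≤h ∷ ≤hs) =
    ∈-cartesianProductWith⁺ _∷_ (⇐ (∈-interval⇔ l h) (l≤ , ≤h)) (from ls hs (ls≤ , ≤hs))

box-unique : ∀ {n} (lo hi : Vec ℕ n) → Unique (box lo hi)
box-unique []       []       = [] AllPairs.∷ AllPairs.[]
box-unique (l ∷ ls) (h ∷ hs) =
  Uniqueₚ.cartesianProductWith⁺ _∷_ ∷-injective
    (Uniqueₚ.map⁺ (ℕₚ.+-cancelˡ-≡ l _ _) (Uniqueₚ.upTo⁺ (suc h ∸ l)))
    (box-unique ls hs)

-- u = min {𝟙 , k̃}
lower : ∀ {M} → Vec ℕ (suc M) → Vec ℕ (suc M)
lower k = minᵛ (replicate _ 1) (shift k)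

-- V(k), as a duplicate-free list.  Since u ≥ 0, its elements have
-- non-negative entries.
V : ∀ {M} → Vec ℕ (suc M) → List (Vec ℕ (suc M))
V k = box (lower k) (minᵛ k (shift k))

-- The depth z_j (-1 ≤ j ≤ M) is represented by the index j + 1.
Depth : ℕ → Set
Depth M = Fin (suc (suc M))

infix 4 _⋖_ _⋖?_
_⋖_ : ∀ {M} → Rel (Depth M) 0ℓ
x ⋖ y = suc (toℕ x) ≡ toℕ y

_⋖?_ : ∀ {M} (x y : Depth M) → Dec (x ⋖ y)
x ⋖? y = suc (toℕ x) ℕₚ.≟ toℕ y

record IsScatteringSequence {M} (p : List (Depth M)) : Set where
  field
    interior         : List (Depth M)
    endpoints        : p ≡ (zero ∷ interior) ∷ʳ zero
    nonempty         : interior ≢ []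
    interior-below   : All (_≢ zero) interior
    steps            : Linked (λ x y → x ⋖ y ⊎ y ⋖ x) p

-- The j for which z_{j-1} and z_j are the endpoints of a step, i.e. the index
-- of the deeper endpoint; the value at (zero , zero) plays no role.
layer : ∀ {M} → Depth M → Depth M → Fin (suc M)
layer zero    zero    = zero
layer zero    (suc j) = j
layer (suc i) zero    = i
layer (suc i) (suc j) = if toℕ i ℕ.≤ᵇ toℕ j then j else i

module Layered {c ℓ₁ ℓ₂ ℓ₃} (ℝ : RealField c ℓ₁ ℓ₂ ℓ₃) where
  open RealField ℝ

  -- v is the sum of f over the set P, where f vanishes at all but finitely
  -- many elements of P.
  IsSum : ∀ {I : Set} → (I → Set) → (I → Carrier) → Carrier → Set ℓ₁
  IsSum {I} P f v =
    Σ (List I) λ xs →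
      Unique xs × All P xs × (∀ i → P i → i ∉ xs → f i ≈ 0#) × (v ≈ ∑ xs f)

  -- The formal sum  Σ_{i ∈ Member} weight i · δ(t − time i).
  record DeltaSum : Set (lsuc 0ℓ ⊔ c) where
    field
      Index  : Set
      Member : Index → Set
      weight : Index → Carrier
      time   : Index → Carrier

  -- Since the sums in question are locally finite, they can be paired with any
  -- compactly supported function; no regularity is required.  (Classically the
  -- indicator of {t} is a test function, and pairing with it gives the
  -- combined coefficient at time t.)
  record TestFunction : Set (c ⊔ ℓ₁ ⊔ ℓ₃) where
    field
      φ        : Carrier → Carrier
      φ-cong   : ∀ {s t} → s ≈ t → φ s ≈ φ t
      bound    : Carrier
      vanishes : ∀ t → (t < - bound) ⊎ (bound < t) → φ t ≈ 0#

  ⟪_,_⟫≈_ : DeltaSum → TestFunction → Carrier → Set ℓ₁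
  ⟪ D , ψ ⟫≈ v = IsSum Member (λ i → weight i * φ (time i)) v
    where
    open DeltaSum D
    open TestFunction ψ

  -- Both pairings exist and have the same value (a pairing has at most one
  -- value up to ≈).
  infix 4 _≐_
  _≐_ : DeltaSum → DeltaSum → Set (c ⊔ ℓ₁ ⊔ ℓ₃)
  D ≐ E = ∀ ψ → ∃[ v ] (⟪ D , ψ ⟫≈ v) × (⟪ E , ψ ⟫≈ v)

  record Medium (M : ℕ) : Set (c ⊔ ℓ₃) where
    field
      τ     : Vec Carrier (suc M)
      R     : Vec Carrier (suc M)
      τ-pos : ∀ n → 0# < lookup τ n
      R>-1  : ∀ n → - 1# < lookup R n
      R<1   : ∀ n → lookup R n < 1#

  IsTransmission : ∀ {M} → Vec Carrier (suc M) → Vec Carrier (suc M) → Set (ℓ₁ ⊔ ℓ₃)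
  IsTransmission R T = ∀ n → IsSqrt (1# - lookup R n * lookup R n) (lookup T n)

  module _ {M} (R T : Vec Carrier (suc M)) where

    -- The factor w_i at p_i = y, with p_{i-1} = x and p_{i+1} = z.  The value
    -- at y = z_{-1} plays no role.
    factor : Depth M → Depth M → Depth M → Carrier
    factor x zero    z = 1#
    factor x (suc j) z =
      if does (x ⋖? suc j ×-dec z ⋖? suc j) then lookup R j
      else if does (suc j ⋖? x ×-dec suc j ⋖? z) then - lookup R j
      else lookup T j

    weightOf : List (Depth M) → Carrier
    weightOf (x ∷ y ∷ z ∷ p) = factor x y z * weightOf (y ∷ z ∷ p)
    weightOf _               = 1#

  arrivalTime : ∀ {M} → Vec Carrier (suc M) → List (Depth M) → Carrier
  arrivalTime τ (x ∷ y ∷ p) = lookup τ (layer x y) * ½ + arrivalTime τ (y ∷ p)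
  arrivalTime τ _           = 0#

  greensFunction : ∀ {M} → (τ R T : Vec Carrier (suc M)) → DeltaSum
  greensFunction {M} τ R T = record
    { Index  = List (Depth M)
    ; Member = IsScatteringSequence
    ; weight = weightOf R T
    ; time   = arrivalTime τ
    }

  infixr 8 _^ᵛ_
  _^ᵛ_ : ∀ {n} → Vec Carrier n → Vec ℕ n → Carrier
  s ^ᵛ d = Vec.foldr′ _*_ 1# (zipWith _^_ s d)

  ⟨_,_⟩ : ∀ {n} → Vec ℕ n → Vec Carrier n → Carrier
  ⟨ k , τ ⟩ = Vec.foldr′ _+_ 0# (zipWith _·_ k τ)

  amplitude : ∀ {M} → (R T : Vec Carrier (suc M)) → Vec ℕ (suc M) → Carrier
  amplitude R T k = ∑ (V k) λ b →
    (binomᵛ k b ℕ.* binomᵛ (k̃ ∸ᵛ u) (b ∸ᵛ u)) ·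
      (Vec.map -_ R ^ᵛ (k̃ ∸ᵛ b) * R ^ᵛ (k ∸ᵛ b) * T ^ᵛ Vec.map (2 ℕ.*_) b)
    where
    k̃ = shift k
    u = lower k

  explicitSum : ∀ {M} → (τ R T : Vec Carrier (suc M)) → DeltaSum
  explicitSum {M} τ R T = record
    { Index  = Vec ℕ (suc M)
    ; Member = Is𝔏
    ; weight = amplitude R T
    ; time   = λ k → ⟨ k , τ ⟩
    }

{-# OPTIONS --safe #-}
module Submission where

-- Read a scattering sequence one step at a time, remembering the current node,
-- the direction in which it was entered, and the numbers k_n of downward
-- crossings of layer n still to come.  The total weight of all continuations
-- from such a state satisfies a linear recursion on the next step, and this
-- recursion is solved by a product over the levels: the factor of level n
-- depends only on x = k_n and y = k_{n+1} and on whether the walk is above,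
-- at, or below z_n.  For a level from which the walk has already descended
-- during the current visit to z_n, the factor is
--   T Σ_b C(x,b) C(y,b) (−R)^{y−b} R^{x−b} T^{2b},
-- by Pascal's rule in x and in y; at the start the product is a(R,k).
--
-- Against a test function only finitely many k matter: by the Archimedean
-- property, ⟨k,τ⟩ exceeds the bound of the support as soon as one entry of k is
-- large.  Outside 𝔏 the product vanishes.

open import Defs
open import Data.Nat.Base as ℕ using (ℕ; zero; suc; _∸_; z≤n; s≤s)
open import Data.Vec.Base as Vec using (Vec; []; _∷_; sum; replicate; lookup)
open import Algebra.Bundles using (CommutativeRing)
import Algebra.Properties.Ring as RingProperties
import Algebra.Properties.Semiring.Mult as SemiringMult
import Algebra.Solver.Ring.NaturalCoefficients.Default as SemiringSolver
open import Data.Bool.Base using (true; false; if_then_else_)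
open import Data.Fin.Base using (Fin; zero; suc; toℕ; inject₁)
open import Data.Fin.Properties as Finₚ using (toℕ-injective; toℕ-inject₁)
open import Data.List.Base as List using (List; []; _∷_; _++_; _∷ʳ_)
open import Data.List.Membership.Propositional using (_∈_; _∉_)
open import Data.List.Membership.Propositional.Properties
  using (∈-++⁻; ∈-++⁺ˡ; ∈-++⁺ʳ; ∈-map⁺; ∈-map⁻; ∈-concat⁺′; ∈-filter⁺)
open import Data.List.Properties using (∷-injectiveʳ)
open import Data.List.Relation.Binary.Disjoint.Propositional using (Disjoint)
open import Data.List.Relation.Unary.All as All using (All; []; _∷_)
import Data.List.Relation.Unary.All.Properties as Allₚ
open import Data.List.Relation.Unary.AllPairs as AllPairs using ([]; _∷_)
import Data.List.Relation.Unary.AllPairs.Properties as AllPairsₚ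
open import Data.List.Relation.Unary.Any using (here; there)
open import Data.List.Relation.Unary.Linked using (Linked; [-]; _∷_)
open import Data.List.Relation.Unary.Unique.Propositional using (Unique)
import Data.List.Relation.Unary.Unique.Propositional.Properties as Uniqueₚ
open import Data.Maybe.Base as Maybe using (Maybe; just; nothing; maybe′)
open import Data.Nat.Combinatorics using (_C_; k>n⇒nCk≡0; nCk+nC[k+1]≡[n+1]C[k+1])
import Data.Nat.Properties as ℕₚ
open import Data.Product.Base using (∃-syntax; _×_; _,_; proj₁; proj₂)
open import Data.Sum.Base as Sum using (_⊎_; inj₁; inj₂)
open import Data.Unit.Base using (tt)
import Data.Vec.Properties as Vecₚ
open import Data.Vec.Relation.Binary.Pointwise.Inductive using ([]; _∷_)
open import Function.Base using (_∘_; id)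
open import Function.Bundles using (module Equivalence)
open import Relation.Binary.PropositionalEquality as ≡ using (_≡_; _≢_; refl; cong; subst)
import Relation.Binary.Reasoning.Setoid as SetoidReasoning
open import Relation.Binary.Structures using (IsStrictPartialOrder)
open import Relation.Nullary.Decidable using (Dec; yes; no; does; _×-dec_; _→-dec_)
open import Relation.Nullary.Negation using (¬_; contradiction)

-- Downward steps and the counts of crossings to come

-- Descent i k j k′: from node i, with k_n crossings of layer n still to come,
-- cross one layer downwards to node j, leaving k′.
data Descent : ∀ {n} → Fin n → Vec ℕ n → Fin n → Vec ℕ n → Set where
  here  : ∀ {n x y} {k : Vec ℕ n} →
          Descent zero (x ∷ suc y ∷ k) (suc zero) (x ∷ y ∷ k)
  there : ∀ {n x i j} {k k′ : Vec ℕ n} →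
          Descent i k j k′ → Descent (suc i) (x ∷ k) (suc j) (x ∷ k′)

Descents : ∀ {n} → Fin n → Vec ℕ n → Set
Descents {n} i k = ∃[ j ] ∃[ k′ ] Descent {n} i k j k′

there′ : ∀ {n x i} {k : Vec ℕ n} → Descents i k → Descents (suc i) (x ∷ k)
there′ (j , k′ , d) = suc j , _ ∷ k′ , there d

descend : ∀ {n} (i : Fin n) k → Maybe (Descents i k)
descend zero    (x ∷ [])        = nothing
descend zero    (x ∷ zero  ∷ k) = nothing
descend zero    (x ∷ suc y ∷ k) = just (_ , _ , here)
descend (suc i) (x ∷ k)         = Maybe.map there′ (descend i k)

descend-complete : ∀ {n} {i j : Fin n} {k k′} (d : Descent i k j k′) →
                   descend i k ≡ just (j , k′ , d)
descend-complete here      = refl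
descend-complete (there d) = cong (Maybe.map there′) (descend-complete d)

Descent-toℕ : ∀ {n} {i j : Fin n} {k k′} → Descent i k j k′ → suc (toℕ i) ≡ toℕ j
Descent-toℕ here      = refl
Descent-toℕ (there d) = cong suc (Descent-toℕ d)

Descent-sum : ∀ {n} {i j : Fin n} {k k′} → Descent i k j k′ → sum k ≡ suc (sum k′)
Descent-sum (here {x = x}) = ℕₚ.+-suc x _
Descent-sum (there {x = x} d) = ≡.trans (cong (x ℕ.+_) (Descent-sum d)) (ℕₚ.+-suc x _)

head₀ : ∀ {n} → Vec ℕ n → ℕ
head₀ []      = 0
head₀ (x ∷ _) = x

Descent-head₀ : ∀ {n} {i j : Fin n} {k k′} → Descent i k j k′ → head₀ k ≡ head₀ k′
Descent-head₀ here      = refl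
Descent-head₀ (there _) = refl

Descent-injective : ∀ {n} {i j : Fin n} {k₁ k₂ k′} →
                    Descent i k₁ j k′ → Descent i k₂ j k′ → k₁ ≡ k₂
Descent-injective here      here      = refl
Descent-injective (there d) (there e) = cong (_ ∷_) (Descent-injective d e)

-- Raising the entry of the crossed layer by one recovers the counts before the step. This lets
-- counts be assigned to a sequence from its end, where they are all zero.
ascend : ∀ {n} {i j : Fin n} → suc (toℕ i) ≡ toℕ j → ∀ k′ → ∃[ k ] Descent i k j k′
ascend {i = zero}  {suc zero}    _  (x ∷ y ∷ k) = _ , here
ascend {i = suc i} {suc j}       eq (x ∷ k) with ascend (ℕₚ.suc-injective eq) k
... | _ , d = _ , there d

-- Walks as remainders of scattering sequences

-- The walk from the node z_i to z_{-1} (z_i itself is left out of the list)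
-- crosses layer n downwards k_n times.  A walk that ends at z_{-1} is the
-- remainder of a scattering sequence, so k_0 = 0 throughout.
data Walk {n} : Fin n → Vec ℕ n → List (Fin (suc n)) → Set where
  stop : ∀ {i k} → toℕ i ≡ 0 → k ≡ replicate n 0 → Walk i k (zero ∷ [])
  up   : ∀ {i j k p} → suc (toℕ j) ≡ toℕ i → Walk j k p → Walk i k (suc j ∷ p)
  down : ∀ {i j k k′ p} → Descent i k j k′ → Walk j k′ p → Walk i k (suc j ∷ p)

-- The list alone fixes the counts: the next node tells a rise from a fall, since being both would
-- make an index equal to itself plus two. Hence sequences with different counts are different.
Walk-unique : ∀ {n} {i : Fin n} {k₁ k₂ p} → Walk i k₁ p → Walk i k₂ p → k₁ ≡ k₂
Walk-unique (stop _ refl) (stop _ refl) = refl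
Walk-unique (up _ w)      (up _ v)      = Walk-unique w v
Walk-unique (up eq w)     (down d v)    =
  contradiction (≡.trans (cong suc eq) (Descent-toℕ d)) (ℕₚ.m≢1+n+m _ {1} ∘ ≡.sym)
Walk-unique (down d w)    (up eq v)     =
  contradiction (≡.trans (cong suc eq) (Descent-toℕ d)) (ℕₚ.m≢1+n+m _ {1} ∘ ≡.sym)
Walk-unique (down d w)    (down e v) with refl ← Walk-unique w v = Descent-injective d e

-- A descent from a node enters layer 1 or a deeper one, so the entry of layer 0 keeps the value 0
-- that it has at the end.
Walk-head₀ : ∀ {n} {i : Fin n} {k p} → Walk i k p → head₀ k ≡ 0
Walk-head₀ {suc n} (stop _ refl) = refl
Walk-head₀ (up _ w)      = Walk-head₀ w
Walk-head₀ (down d w)    = ≡.trans (Descent-head₀ d) (Walk-head₀ w)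

Linked⇒Walk : ∀ {M} (i : Fin (suc M)) q → All (_≢ zero) q →
              Linked (λ x y → x ⋖ y ⊎ y ⋖ x) (suc i ∷ q ∷ʳ zero) → ∃[ k ] Walk i k (q ∷ʳ zero)
Linked⇒Walk i []            _         (inj₂ eq ∷ [-]) =
  _ , stop (≡.sym (ℕₚ.suc-injective eq)) refl
Linked⇒Walk i (zero  ∷ q)  (z≢ ∷ _)   _ = contradiction refl z≢
Linked⇒Walk i (suc j ∷ q) (_ ∷ q≢) (s ∷ l) with Linked⇒Walk j q q≢ l
Linked⇒Walk i (suc j ∷ q) (_ ∷ q≢) (inj₁ eq ∷ l) | k′ , w with ascend (ℕₚ.suc-injective eq) k′
... | k , d = k , down d w
Linked⇒Walk i (suc j ∷ q) (_ ∷ q≢) (inj₂ eq ∷ l) | k′ , w =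
  k′ , up (ℕₚ.suc-injective eq) w

Walk⇒Linked : ∀ {M} {i : Fin (suc M)} {k p} → Walk i k p →
              ∃[ q ] p ≡ q ∷ʳ zero × All (_≢ zero) q ×
                     Linked (λ x y → x ⋖ y ⊎ y ⋖ x) (suc i ∷ p)
Walk⇒Linked (stop eq _) = [] , refl , [] , inj₂ (cong suc (≡.sym eq)) ∷ [-]
Walk⇒Linked (up {j = j} eq w) with Walk⇒Linked w
... | q , refl , q≢ , l = suc j ∷ q , refl , (λ ()) ∷ q≢ , inj₂ (cong suc eq) ∷ l
Walk⇒Linked (down {j = j} d w) with Walk⇒Linked w
... | q , refl , q≢ , l = suc j ∷ q , refl , (λ ()) ∷ q≢ , inj₁ (cong suc (Descent-toℕ d)) ∷ l

Walk⇒scattering : ∀ {M} {k : Vec ℕ (suc M)} {p} → Walk zero k p →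
                  IsScatteringSequence (zero ∷ suc zero ∷ p)
Walk⇒scattering w with Walk⇒Linked w
... | q , refl , q≢ , l = record
  { interior       = suc zero ∷ q
  ; endpoints      = refl
  ; nonempty       = λ ()
  ; interior-below = (λ ()) ∷ q≢
  ; steps          = inj₁ refl ∷ l
  }

-- Depths along a sequence change by one index at a time, so the first interior node must be z_0.
-- The initial crossing of layer 0 is not counted by the walk, whence the entry 0.
scattering⇒Walk : ∀ {M} {p : List (Depth M)} → IsScatteringSequence p →
                  ∃[ k ] ∃[ q ] p ≡ zero ∷ suc zero ∷ q × Walk zero (0 ∷ k) q
scattering⇒Walk record { interior = [] ; nonempty = ≢[] } = contradiction refl ≢[]
scattering⇒Walk record { interior = zero ∷ q ; interior-below = z≢ ∷ _ } = contradiction refl z≢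
scattering⇒Walk record { interior = suc zero ∷ q ; endpoints = refl
                       ; interior-below = _ ∷ q≢ ; steps = _ ∷ l }
  with Linked⇒Walk zero q q≢ l
... | x ∷ k , w with refl ← Walk-head₀ w = k , q ∷ʳ zero , refl , w
scattering⇒Walk record { interior = suc (suc _) ∷ q ; endpoints = refl
                       ; steps = inj₁ () ∷ _ }
scattering⇒Walk record { interior = suc (suc _) ∷ q ; endpoints = refl
                       ; steps = inj₂ () ∷ _ }

-- Enumeration of the walks with given counts

-- The first argument bounds the number of steps.
mutual
  walks : ∀ {n} → ℕ → Fin n → Vec ℕ n → List (List (Fin (suc n)))
  walks zero    i k = []
  walks (suc f) i k = rises f i k ++ falls f i k

  rises : ∀ {n} → ℕ → Fin n → Vec ℕ n → List (List (Fin (suc n)))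
  rises f zero    k = stops k
  rises f (suc j) k = List.map (suc (inject₁ j) ∷_) (walks f (inject₁ j) k)

  falls : ∀ {n} → ℕ → Fin n → Vec ℕ n → List (List (Fin (suc n)))
  falls f i k = maybe′ (λ (j , k′ , _) → List.map (suc j ∷_) (walks f j k′)) [] (descend i k)

  stops : ∀ {n} → Vec ℕ n → List (List (Fin (suc n)))
  stops {n} k with Vecₚ.≡-dec ℕₚ._≟_ k (replicate n 0)
  ... | yes _ = (zero ∷ []) ∷ []
  ... | no  _ = []

∈-stops⁻ : ∀ {n} (k : Vec ℕ (suc n)) {p} → p ∈ stops k → Walk zero k p
∈-stops⁻ {n} k p∈ with Vecₚ.≡-dec ℕₚ._≟_ k (replicate (suc n) 0)
∈-stops⁻ k (here refl) | yes k≡0 = stop refl k≡0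

mutual
  ∈-walks⁻ : ∀ {n} f (i : Fin n) k {p} → p ∈ walks f i k → Walk i k p
  ∈-walks⁻ (suc f) i k p∈ with ∈-++⁻ (rises f i k) p∈
  ... | inj₁ p∈rises = ∈-rises⁻ f i k p∈rises
  ... | inj₂ p∈falls = ∈-falls⁻ f i k p∈falls

  ∈-rises⁻ : ∀ {n} f (i : Fin n) k {p} → p ∈ rises f i k → Walk i k p
  ∈-rises⁻ f zero    k p∈ = ∈-stops⁻ k p∈
  ∈-rises⁻ f (suc j) k p∈ with ∈-map⁻ _ p∈
  ... | q , q∈ , refl = up (cong suc (toℕ-inject₁ j)) (∈-walks⁻ f (inject₁ j) k q∈)

  ∈-falls⁻ : ∀ {n} f (i : Fin n) k {p} → p ∈ falls f i k → Walk i k p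
  ∈-falls⁻ f i k p∈ with just (j , k′ , d) ← descend i k with ∈-map⁻ _ p∈
  ... | q , q∈ , refl = down d (∈-walks⁻ f j k′ q∈)

steps : ∀ {n} → Fin n → Vec ℕ n → ℕ
steps i k = suc (toℕ i) ℕ.+ (sum k ℕ.+ sum k)

steps-up : ∀ {n} {i j : Fin n} k → suc (toℕ j) ≡ toℕ i → steps i k ≡ suc (steps j k)
steps-up k eq = cong (λ m → suc m ℕ.+ _) (≡.sym eq)

steps-down : ∀ {n} {i j : Fin n} {k k′} → Descent i k j k′ → steps i k ≡ suc (steps j k′)
steps-down {i = i} {k′ = k′} d rewrite Descent-sum d | ≡.sym (Descent-toℕ d)
  | ℕₚ.+-suc (sum k′) (sum k′) | ℕₚ.+-suc (toℕ i) (suc (sum k′ ℕ.+ sum k′))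
  | ℕₚ.+-suc (toℕ i) (sum k′ ℕ.+ sum k′) = refl

∈-walks⁺ : ∀ {n} f {i : Fin n} {k p} → Walk i k p → steps i k ℕ.≤ f → p ∈ walks f i k
∈-walks⁺ {suc n} (suc f) {i = zero} {k} (stop refl k≡0) _
  with Vecₚ.≡-dec ℕₚ._≟_ k (replicate (suc n) 0)
... | yes _  = here refl
... | no k≢0 = contradiction k≡0 k≢0
∈-walks⁺ (suc f) {i = suc i} {k} (up {j = j} eq w) s≤
  -- A rise in a `Walk` only fixes the index of its target, while the enumeration names the target
  -- `inject₁ i`; the two must be identified.
  with refl ← toℕ-injective {i = j} {inject₁ i}
                (≡.trans (ℕₚ.suc-injective eq) (≡.sym (toℕ-inject₁ i))) =
  ∈-++⁺ˡ (∈-map⁺ _ (∈-walks⁺ f w (ℕₚ.≤-pred (subst (ℕ._≤ suc f) (steps-up k eq) s≤))))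
∈-walks⁺ (suc f) {i} {k} (down d w) s≤ = ∈-++⁺ʳ (rises f i k)
  (subst (λ m → _ ∈ maybe′ _ [] m) (≡.sym (descend-complete d))
    (∈-map⁺ _ (∈-walks⁺ f w (ℕₚ.≤-pred (subst (ℕ._≤ suc f) (steps-down d) s≤)))))

∈-rises-head : ∀ {n} f (i : Fin n) k {z q} → z ∷ q ∈ rises f i k → toℕ z ℕ.≤ toℕ i
∈-rises-head {suc n} f zero k p∈ with Vecₚ.≡-dec ℕₚ._≟_ k (replicate (suc n) 0)
∈-rises-head f zero    k (here refl) | yes _ = ℕ.z≤n
∈-rises-head f (suc j) k p∈ with ∈-map⁻ _ p∈
... | _ , _ , refl = ℕ.s≤s (ℕₚ.≤-reflexive (toℕ-inject₁ j))

-- The first node separates the two lists: its depth index is at most `toℕ i` in a rise and `toℕ i`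
-- plus two in a fall.
rises-falls-disjoint : ∀ {n} f (i : Fin n) k {p} → ¬ (p ∈ rises f i k × p ∈ falls f i k)
rises-falls-disjoint f i k (p∈rises , p∈falls)
  with just (j , k′ , d) ← descend i k with ∈-map⁻ _ p∈falls
... | q , _ , refl = ℕₚ.<⇒≱ (ℕₚ.<-trans (ℕₚ.n<1+n _) (ℕₚ.n<1+n _))
  (subst (λ m → suc m ℕ.≤ toℕ i) (≡.sym (Descent-toℕ d)) (∈-rises-head f i k p∈rises))

mutual
  walks-unique : ∀ {n} f (i : Fin n) k → Unique (walks f i k)
  walks-unique zero    i k = []
  walks-unique (suc f) i k =
    Uniqueₚ.++⁺ (rises-unique f i k) (falls-unique f i k) (rises-falls-disjoint f i k)

  rises-unique : ∀ {n} f (i : Fin n) k → Unique (rises f i k)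
  rises-unique {suc n} f zero k with Vecₚ.≡-dec ℕₚ._≟_ k (replicate (suc n) 0)
  ... | yes _ = [] ∷ []
  ... | no  _ = []
  rises-unique f (suc j) k = Uniqueₚ.map⁺ ∷-injectiveʳ (walks-unique f (inject₁ j) k)

  falls-unique : ∀ {n} f (i : Fin n) k → Unique (falls f i k)
  falls-unique f i k with descend i k
  ... | just (j , k′ , _) = Uniqueₚ.map⁺ ∷-injectiveʳ (walks-unique f j k′)
  ... | nothing           = []

-- Scattering sequences grouped by their counts

fullWalks : ∀ {n} → Fin n → Vec ℕ n → List (List (Fin (suc n)))
fullWalks i k = walks (steps i k) i k

sequences : ∀ {M} → Vec ℕ M → List (List (Depth M))
sequences k = List.map (λ q → zero ∷ suc zero ∷ q) (fullWalks zero (0 ∷ k))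

∈-sequences⁻ : ∀ {M} (k : Vec ℕ M) {p} → p ∈ sequences k →
               ∃[ q ] p ≡ zero ∷ suc zero ∷ q × Walk zero (0 ∷ k) q
∈-sequences⁻ k p∈ with ∈-map⁻ _ p∈
... | q , q∈ , refl = q , refl , ∈-walks⁻ (steps zero (0 ∷ k)) zero (0 ∷ k) q∈

∈-sequences⁺ : ∀ {M} {k : Vec ℕ M} {q} → Walk zero (0 ∷ k) q → zero ∷ suc zero ∷ q ∈ sequences k
∈-sequences⁺ {k = k} w = ∈-map⁺ _ (∈-walks⁺ (steps zero (0 ∷ k)) w ℕₚ.≤-refl)

sequences-unique : ∀ {M} (k : Vec ℕ M) → Unique (sequences k)
sequences-unique k =
  Uniqueₚ.map⁺ (∷-injectiveʳ ∘ ∷-injectiveʳ) (walks-unique (steps zero (0 ∷ k)) zero (0 ∷ k))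

sequences-disjoint : ∀ {M} (k k′ : Vec ℕ M) → k ≢ k′ → Disjoint (sequences k) (sequences k′)
sequences-disjoint k k′ k≢k′ (p∈ , p∈′) with ∈-sequences⁻ k p∈ | ∈-sequences⁻ k′ p∈′
... | _ , refl , w | _ , refl , w′ = k≢k′ (Vecₚ.∷-injectiveʳ (Walk-unique w w′))

data Direction : Set where
  ↘ ↗ : Direction

module Weights {c ℓ₁ ℓ₂ ℓ₃} (ℝ : RealField c ℓ₁ ℓ₂ ℓ₃) where
  open RealField ℝ hiding (zero)
  open Layered ℝ
  private module CR = CommutativeRing commutativeRing
  open CR using (commutativeSemiring; reflexive)
  open SemiringMult semiring
    using (×-comm-*; ×-assoc-*; ×-assocˡ; ×-homo-+; ×-congʳ; ×-congˡ)
  open SemiringSolver commutativeSemiring using (solve; _:=_; _:+_; _:*_; con)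
  open RingProperties CR.ring using (-0#≈0#)
  open SetoidReasoning CR.setoid
  open IsStrictPartialOrder isStrictPartialOrder
    using (<-respˡ-≈; <-respʳ-≈) renaming (trans to <-trans)

  private variable
    I J : Set

  -- Finite sums

  ∑-cong-∈ : ∀ (xs : List I) {f g} → (∀ {x} → x ∈ xs → f x ≈ g x) → ∑ xs f ≈ ∑ xs g
  ∑-cong-∈ []       f≈g = ≈-refl
  ∑-cong-∈ (x ∷ xs) f≈g = +-cong (f≈g (here refl)) (∑-cong-∈ xs (f≈g ∘ there))

  ∑-cong : ∀ (xs : List I) {f g} → (∀ x → f x ≈ g x) → ∑ xs f ≈ ∑ xs g
  ∑-cong xs f≈g = ∑-cong-∈ xs λ {x} _ → f≈g x

  ∑-++ : ∀ (xs ys : List I) f → ∑ (xs ++ ys) f ≈ ∑ xs f + ∑ ys f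
  ∑-++ []       ys f = ≈-sym (+-identityˡ _)
  ∑-++ (x ∷ xs) ys f = ≈-trans (+-congˡ (∑-++ xs ys f)) (≈-sym (+-assoc _ _ _))

  ∑-map : ∀ (h : I → J) xs f → ∑ (List.map h xs) f ≡ ∑ xs (f ∘ h)
  ∑-map h []       f = refl
  ∑-map h (x ∷ xs) f = cong (f (h x) +_) (∑-map h xs f)

  ∑-concatMap : ∀ (h : I → List J) xs f → ∑ (List.concatMap h xs) f ≈ ∑ xs (λ x → ∑ (h x) f)
  ∑-concatMap h []       f = ≈-refl
  ∑-concatMap h (x ∷ xs) f =
    ≈-trans (∑-++ (h x) (List.concatMap h xs) f) (+-congˡ (∑-concatMap h xs f))

  ∑-*ˡ : ∀ a (xs : List I) f → ∑ xs (λ x → a * f x) ≈ a * ∑ xs f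
  ∑-*ˡ a []       f = ≈-sym (zeroʳ a)
  ∑-*ˡ a (x ∷ xs) f = ≈-trans (+-congˡ (∑-*ˡ a xs f)) (≈-sym (distribˡ _ _ _))

  ∑-*ʳ : ∀ a (xs : List I) f → ∑ xs (λ x → f x * a) ≈ ∑ xs f * a
  ∑-*ʳ a []       f = ≈-sym (zeroˡ a)
  ∑-*ʳ a (x ∷ xs) f = ≈-trans (+-congˡ (∑-*ʳ a xs f)) (≈-sym (distribʳ _ _ _))

  ∑-product : ∀ {K : Set} (h : I → J → K) xs ys {f : I → Carrier} {g : J → Carrier} {e} →
              (∀ x y → e (h x y) ≈ f x * g y) →
              ∑ (List.cartesianProductWith h xs ys) e ≈ ∑ xs f * ∑ ys g
  ∑-product h []       ys           e≈ = ≈-sym (zeroˡ _)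
  ∑-product h (x ∷ xs) ys {f} {g} {e} e≈ = begin
    ∑ (List.map (h x) ys ++ List.cartesianProductWith h xs ys) e
      ≈⟨ ∑-++ (List.map (h x) ys) _ e ⟩
    ∑ (List.map (h x) ys) e + ∑ (List.cartesianProductWith h xs ys) e
      ≡⟨ cong (_+ _) (∑-map (h x) ys e) ⟩
    ∑ ys (λ y → e (h x y)) + ∑ (List.cartesianProductWith h xs ys) e
      ≈⟨ +-cong (≈-trans (∑-cong ys (e≈ x)) (∑-*ˡ (f x) ys g)) (∑-product h xs ys e≈) ⟩
    f x * ∑ ys g + ∑ xs f * ∑ ys g
      ≈⟨ ≈-sym (distribʳ _ _ _) ⟩
    ∑ (x ∷ xs) f * ∑ ys g ∎

  ∑< : ℕ → (ℕ → Carrier) → Carrier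
  ∑< zero    f = 0#
  ∑< (suc n) f = f 0 + ∑< n (f ∘ suc)

  ∑<-cong : ∀ n {f g} → (∀ i → f i ≈ g i) → ∑< n f ≈ ∑< n g
  ∑<-cong zero    f≈g = ≈-refl
  ∑<-cong (suc n) f≈g = +-cong (f≈g 0) (∑<-cong n (f≈g ∘ suc))

  ∑<-0 : ∀ n {f} → (∀ i → f i ≈ 0#) → ∑< n f ≈ 0#
  ∑<-0 zero    f≈0 = ≈-refl
  ∑<-0 (suc n) f≈0 = ≈-trans (+-cong (f≈0 0) (∑<-0 n (f≈0 ∘ suc))) (+-identityˡ 0#)

  ∑<-+ : ∀ n f g → ∑< n (λ i → f i + g i) ≈ ∑< n f + ∑< n g
  ∑<-+ zero    f g = ≈-sym (+-identityˡ 0#)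
  ∑<-+ (suc n) f g = ≈-trans (+-congˡ (∑<-+ n (f ∘ suc) (g ∘ suc)))
    (solve 4 (λ a b x y → (a :+ b) :+ (x :+ y) := (a :+ x) :+ (b :+ y)) ≈-refl _ _ _ _)

  ∑<-* : ∀ n a f → ∑< n (λ i → a * f i) ≈ a * ∑< n f
  ∑<-* zero    a f = ≈-sym (zeroʳ a)
  ∑<-* (suc n) a f = ≈-trans (+-congˡ (∑<-* n a (f ∘ suc))) (≈-sym (distribˡ _ _ _))

  ∑<-extend : ∀ {m n} f → m ℕ.≤ n → (∀ i → m ℕ.≤ i → f i ≈ 0#) → ∑< m f ≈ ∑< n f
  ∑<-extend {n = n} f z≤n f≈0 = ≈-sym (∑<-0 n λ i → f≈0 i z≤n)
  ∑<-extend f (s≤s m≤n) f≈0 = +-congˡ (∑<-extend (f ∘ suc) m≤n λ i m≤i → f≈0 (suc i) (s≤s m≤i))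

  ∑-applyUpTo : ∀ (g h : ℕ → ℕ) n f →
                ∑ (List.map g (List.applyUpTo h n)) f ≡ ∑< n (f ∘ g ∘ h)
  ∑-applyUpTo g h zero    f = refl
  ∑-applyUpTo g h (suc n) f = cong (f (g (h 0)) +_) (∑-applyUpTo g (h ∘ suc) n f)

  -- Weights of walks

  -- The first direction is that of arrival, the second that of departure.
  coef : Direction → Direction → Carrier → Carrier → Carrier
  coef ↘ ↗ r t = r
  coef ↗ ↘ r t = - r
  coef ↘ ↘ r t = t
  coef ↗ ↗ r t = t

  -- Total weight of the remaining visits to one level, when x more descents to
  -- its node and y more descents from it are to come: nodeWeight if the walk is
  -- now at the node (entered in direction d) or below it, levelWeight if above.
  mutual
    levelWeight : Carrier → Carrier → ℕ → ℕ → Carrier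
    levelWeight r t zero    zero    = 1#
    levelWeight r t zero    (suc y) = 0#
    levelWeight r t (suc x) y       = nodeWeight r t ↘ x y

    nodeWeight : Carrier → Carrier → Direction → ℕ → ℕ → Carrier
    nodeWeight r t d x y = coef d ↗ r t * levelWeight r t x y + coef d ↘ r t * childWeight r t x y

    childWeight : Carrier → Carrier → ℕ → ℕ → Carrier
    childWeight r t x zero    = 0#
    childWeight r t x (suc y) = nodeWeight r t ↗ x y

  -- Product for a walk above all the levels concerned. Neighbouring entries of k are the only
  -- coupling, and `head₀ []` supplies the final 0 of k̃ to the deepest level.
  forestWeight : ∀ {n} → Vec Carrier n → Vec Carrier n → Vec ℕ n → Carrier
  forestWeight []      []      []      = 1#
  forestWeight (r ∷ R) (t ∷ T) (x ∷ k) = levelWeight r t x (head₀ k) * forestWeight R T k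

  -- Levels shallower than the current node will next be entered from below, hence `↗`; levels
  -- deeper than it have the walk above them.
  walkWeight : ∀ {n} → Vec Carrier n → Vec Carrier n → Direction → Fin n → Vec ℕ n → Carrier
  walkWeight (r ∷ R) (t ∷ T) d zero    (x ∷ k) = nodeWeight r t d x (head₀ k) * forestWeight R T k
  walkWeight (r ∷ R) (t ∷ T) d (suc i) (x ∷ k) =
    nodeWeight r t ↗ x (head₀ k) * walkWeight R T d i k

  -- Rising from z_0 ends the walk. When k_0 = 0, `forestWeight` is then 1 if no crossing is left
  -- and 0 otherwise, as termination requires.
  riseWeight : ∀ {n} → Vec Carrier n → Vec Carrier n → Fin n → Vec ℕ n → Carrier
  riseWeight R T zero    k = forestWeight R T k
  riseWeight R T (suc i) k = walkWeight R T ↗ (inject₁ i) k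

  fallWeight : ∀ {n} → Vec Carrier n → Vec Carrier n → (i : Fin n) → Vec ℕ n → Carrier
  fallWeight R T i k = maybe′ (λ (j , k′ , _) → walkWeight R T ↘ j k′) 0# (descend i k)

  fallWeight-suc : ∀ {n} r t (R T : Vec Carrier n) x i k →
    fallWeight (r ∷ R) (t ∷ T) (suc i) (x ∷ k) ≈ nodeWeight r t ↗ x (head₀ k) * fallWeight R T i k
  fallWeight-suc r t R T x i k with descend i k
  ... | just (j , k′ , d) = *-congʳ (reflexive (cong (nodeWeight r t ↗ x) (≡.sym (Descent-head₀ d))))
  ... | nothing           = ≈-sym (zeroʳ _)

  riseWeight-suc : ∀ {n} r t (R T : Vec Carrier n) x i k →
    riseWeight (r ∷ R) (t ∷ T) (suc i) (x ∷ k) ≈ nodeWeight r t ↗ x (head₀ k) * riseWeight R T i k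
  riseWeight-suc r t R T x zero    k = ≈-refl
  riseWeight-suc r t R T x (suc i) k = ≈-refl

  -- Only the factor of the current level changes in value, and it does so by the recursion defining
  -- `nodeWeight`. The level that is entered keeps its value: on a rise it has `nodeWeight` at `↗`
  -- before and after, and on a fall `levelWeight` at `suc y` is `nodeWeight` at `↘` and `y` by
  -- definition.
  walkWeight-step : ∀ {n} (R T : Vec Carrier n) d i k →
    walkWeight R T d i k ≈
    coef d ↗ (lookup R i) (lookup T i) * riseWeight R T i k +
    coef d ↘ (lookup R i) (lookup T i) * fallWeight R T i k
  walkWeight-step (r ∷ []) (t ∷ []) d zero (x ∷ []) =
    solve 4 (λ a b p z → (a :* p :+ b :* z) :* con 1 := a :* (p :* con 1) :+ b :* z) ≈-refl _ _ _ _
  walkWeight-step (r ∷ r′ ∷ R) (t ∷ t′ ∷ T) d zero (x ∷ zero ∷ k) = begin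
    (a * p + b * 0#) * q
      ≈⟨ solve 4 (λ a b p q → (a :* p :+ b :* con 0) :* q := a :* (p :* q) :+ b :* con 0)
           ≈-refl a b p q ⟩
    a * (p * q) + b * 0# ∎
    where
    a = coef d ↗ r t
    b = coef d ↘ r t
    p = levelWeight r t x 0
    q = forestWeight (r′ ∷ R) (t′ ∷ T) (zero ∷ k)
  walkWeight-step (r ∷ r′ ∷ R) (t ∷ t′ ∷ T) d zero (x ∷ suc y ∷ k) =
    solve 5 (λ a b p z q → (a :* p :+ b :* z) :* q := a :* (p :* q) :+ b :* (z :* q))
      ≈-refl _ _ _ _ _
  walkWeight-step (r ∷ R) (t ∷ T) d (suc i) (x ∷ k) = begin
    n * walkWeight R T d i k
      ≈⟨ *-congˡ (walkWeight-step R T d i k) ⟩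
    n * (a * riseWeight R T i k + b * fallWeight R T i k)
      ≈⟨ solve 5 (λ n a p b q → n :* (a :* p :+ b :* q) := a :* (n :* p) :+ b :* (n :* q))
           ≈-refl _ _ _ _ _ ⟩
    a * (n * riseWeight R T i k) + b * (n * fallWeight R T i k)
      ≈⟨ +-cong (*-congˡ (≈-sym (riseWeight-suc r t R T x i k)))
                (*-congˡ (≈-sym (fallWeight-suc r t R T x i k))) ⟩
    a * riseWeight (r ∷ R) (t ∷ T) (suc i) (x ∷ k) + b * fallWeight (r ∷ R) (t ∷ T) (suc i) (x ∷ k) ∎
    where
    n = nodeWeight r t ↗ x (head₀ k)
    a = coef d ↗ (lookup R i) (lookup T i)
    b = coef d ↘ (lookup R i) (lookup T i)

  forestWeight-0 : ∀ {n} (R T : Vec Carrier n) → forestWeight R T (replicate n 0) ≈ 1#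
  forestWeight-0 []          []          = ≈-refl
  forestWeight-0 (r ∷ [])    (t ∷ [])    = *-identityˡ 1#
  forestWeight-0 (r ∷ r′ ∷ R) (t ∷ t′ ∷ T) =
    ≈-trans (*-identityˡ _) (forestWeight-0 (r′ ∷ R) (t′ ∷ T))

  -- As the first entry is 0, a nonzero k has a zero entry directly followed by a positive one, and
  -- a level that must be left downwards without being reached has weight 0.
  forestWeight-≢0 : ∀ {n} (R T : Vec Carrier n) k → head₀ k ≡ 0 → ¬ (k ≡ replicate n 0) →
                    forestWeight R T k ≈ 0#
  forestWeight-≢0 []           []           []              _    k≢0 = contradiction refl k≢0
  forestWeight-≢0 (r ∷ R)      (t ∷ T)      (_ ∷ [])        refl k≢0 = contradiction refl k≢0
  forestWeight-≢0 (r ∷ r′ ∷ R) (t ∷ t′ ∷ T) (_ ∷ suc y ∷ k) refl _   = zeroˡ _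
  forestWeight-≢0 (r ∷ r′ ∷ R) (t ∷ t′ ∷ T) (_ ∷ zero ∷ k)  refl k≢0 =
    ≈-trans (*-congˡ (forestWeight-≢0 (r′ ∷ R) (t′ ∷ T) (zero ∷ k) refl (k≢0 ∘ cong (0 ∷_))))
            (zeroʳ _)

  -- Total weight of the enumerated walks

  -- y is the depth before (Enters) or after (Leaves) a visit to z_i, and the
  -- direction is that of the step between the two.
  Enters Leaves : ∀ {M} → Direction → Fin (suc M) → Depth M → Set
  Enters ↘ i y = y ⋖ suc i
  Enters ↗ i y = suc i ⋖ y
  Leaves ↘ i y = suc i ⋖ y
  Leaves ↗ i y = y ⋖ suc i

  private
    if-yes : ∀ {p} {P : Set p} (P? : Dec P) {a b : Carrier} → P → (if does P? then a else b) ≡ a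
    if-yes (yes _) _ = refl
    if-yes (no ¬p) p = contradiction p ¬p

    if-no : ∀ {p} {P : Set p} (P? : Dec P) {a b : Carrier} → ¬ P → (if does P? then a else b) ≡ b
    if-no (yes p) ¬p = contradiction p ¬p
    if-no (no _)  _  = refl

  ⋖-asym : ∀ {M} {x y : Depth M} → x ⋖ y → ¬ (y ⋖ x)
  ⋖-asym p q = ℕₚ.m≢1+n+m _ {1} (≡.trans (≡.sym q) (cong suc (≡.sym p)))

  factor-coef : ∀ {M} (R T : Vec Carrier (suc M)) d e {i x z} → Enters d i x → Leaves e i z →
                factor R T x (suc i) z ≡ coef d e (lookup R i) (lookup T i)
  factor-coef R T ↘ ↗ {i} {x} {z} p q = if-yes (x ⋖? suc i ×-dec z ⋖? suc i) (p , q)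
  factor-coef R T ↗ ↘ {i} {x} {z} p q = ≡.trans
    (if-no (x ⋖? suc i ×-dec z ⋖? suc i) λ (p′ , _) → ⋖-asym p p′)
    (if-yes (suc i ⋖? x ×-dec suc i ⋖? z) (p , q))
  factor-coef R T ↘ ↘ {i} {x} {z} p q = ≡.trans
    (if-no (x ⋖? suc i ×-dec z ⋖? suc i) λ (_ , q′) → ⋖-asym q q′)
    (if-no (suc i ⋖? x ×-dec suc i ⋖? z) λ (p′ , _) → ⋖-asym p p′)
  factor-coef R T ↗ ↗ {i} {x} {z} p q = ≡.trans
    (if-no (x ⋖? suc i ×-dec z ⋖? suc i) λ (p′ , _) → ⋖-asym p p′)
    (if-no (suc i ⋖? x ×-dec suc i ⋖? z) λ (_ , q′) → ⋖-asym q q′)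

  module _ {M} (R T : Vec Carrier (suc M)) where

    private
      extend : ∀ d e {x i j} → Enters d i x → Leaves e i (suc j) → ∀ (ps : List (List (Depth M))) →
               ∑ (List.map (suc j ∷_) ps) (λ p → weightOf R T (x ∷ suc i ∷ p)) ≈
               coef d e (lookup R i) (lookup T i) * ∑ ps (λ p → weightOf R T (suc i ∷ suc j ∷ p))
      extend d e {x} {i} {j} p q ps = begin
        ∑ (List.map (suc j ∷_) ps) (λ p → weightOf R T (x ∷ suc i ∷ p))
          ≡⟨ ∑-map (suc j ∷_) ps _ ⟩
        ∑ ps (λ p → factor R T x (suc i) (suc j) * weightOf R T (suc i ∷ suc j ∷ p))
          ≈⟨ ∑-*ˡ _ ps _ ⟩
        factor R T x (suc i) (suc j) * ∑ ps (λ p → weightOf R T (suc i ∷ suc j ∷ p))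
          ≡⟨ cong (_* _) (factor-coef R T d e p q) ⟩
        coef d e (lookup R i) (lookup T i) * ∑ ps (λ p → weightOf R T (suc i ∷ suc j ∷ p)) ∎

      ∑-stops : ∀ d {x} k → Enters d zero x → head₀ k ≡ 0 →
                ∑ (stops k) (λ p → weightOf R T (x ∷ suc zero ∷ p)) ≈
                coef d ↗ (lookup R zero) (lookup T zero) * forestWeight R T k
      ∑-stops d {x} k p k₀≡0 with Vecₚ.≡-dec ℕₚ._≟_ k (replicate (suc M) 0)
      ... | yes refl = begin
        factor R T x (suc zero) zero * 1# + 0#
          ≈⟨ +-identityʳ _ ⟩
        factor R T x (suc zero) zero * 1#
          ≡⟨ cong (_* 1#) (factor-coef R T d ↗ p refl) ⟩
        coef d ↗ (lookup R zero) (lookup T zero) * 1#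
          ≈⟨ *-congˡ (≈-sym (forestWeight-0 R T)) ⟩
        coef d ↗ (lookup R zero) (lookup T zero) * forestWeight R T (replicate (suc M) 0) ∎
      ... | no k≢0   =
        ≈-sym (≈-trans (*-congˡ (forestWeight-≢0 R T k k₀≡0 k≢0)) (zeroʳ _))

    mutual
      -- The enumeration branches exactly as `walkWeight-step` does. The preceding node `x` affects
      -- the weight only through the direction `d`.
      ∑-walks : ∀ f d {x} i k → Enters d i x → head₀ k ≡ 0 → steps i k ℕ.≤ f →
                ∑ (walks f i k) (λ p → weightOf R T (x ∷ suc i ∷ p)) ≈ walkWeight R T d i k
      ∑-walks (suc f) d {x} i k p k₀≡0 s≤ = begin
        ∑ (rises f i k ++ falls f i k) (λ p → weightOf R T (x ∷ suc i ∷ p))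
          ≈⟨ ∑-++ (rises f i k) (falls f i k) _ ⟩
        ∑ (rises f i k) (λ p → weightOf R T (x ∷ suc i ∷ p)) +
        ∑ (falls f i k) (λ p → weightOf R T (x ∷ suc i ∷ p))
          ≈⟨ +-cong (∑-rises f d i k p k₀≡0 s≤) (∑-falls f d i k p k₀≡0 s≤) ⟩
        coef d ↗ (lookup R i) (lookup T i) * riseWeight R T i k +
        coef d ↘ (lookup R i) (lookup T i) * fallWeight R T i k
          ≈⟨ ≈-sym (walkWeight-step R T d i k) ⟩
        walkWeight R T d i k ∎

      ∑-rises : ∀ f d {x} i k → Enters d i x → head₀ k ≡ 0 → steps i k ℕ.≤ suc f →
                ∑ (rises f i k) (λ p → weightOf R T (x ∷ suc i ∷ p)) ≈
                coef d ↗ (lookup R i) (lookup T i) * riseWeight R T i k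
      ∑-rises f d zero    k p k₀≡0 s≤ = ∑-stops d k p k₀≡0
      ∑-rises f d (suc j) k p k₀≡0 s≤ = ≈-trans (extend d ↗ p rise (walks f (inject₁ j) k))
        (*-congˡ (∑-walks f ↗ (inject₁ j) k rise k₀≡0
          (ℕₚ.≤-pred (subst (ℕ._≤ suc f) (steps-up k (ℕₚ.suc-injective rise)) s≤))))
        where
        rise : suc (suc (toℕ (inject₁ j))) ≡ suc (suc (toℕ j))
        rise = cong (λ m → suc (suc m)) (toℕ-inject₁ j)

      ∑-falls : ∀ f d {x} i k → Enters d i x → head₀ k ≡ 0 → steps i k ℕ.≤ suc f →
                ∑ (falls f i k) (λ p → weightOf R T (x ∷ suc i ∷ p)) ≈
                coef d ↘ (lookup R i) (lookup T i) * fallWeight R T i k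
      ∑-falls f d i k p k₀≡0 s≤ with descend i k
      ... | nothing           = ≈-sym (zeroʳ _)
      ... | just (j , k′ , δ) = ≈-trans (extend d ↘ p fall (walks f j k′))
        (*-congˡ (∑-walks f ↘ j k′ fall (≡.trans (≡.sym (Descent-head₀ δ)) k₀≡0)
          (ℕₚ.≤-pred (subst (ℕ._≤ suc f) (steps-down δ) s≤))))
        where
        fall : suc (suc (toℕ i)) ≡ suc (toℕ j)
        fall = cong suc (Descent-toℕ δ)

  -- Closed form of the weight of a level

  module _ (r t : Carrier) where

    -- `visitTerm` is the summand for a level that the walk is below, without the leading T.
    -- `childTerm x y b` is the summand of a(R,k) at a level with k_n = x + 1 and k_{n+1} = y + 1;
    -- there u_n = 1, and the index is shifted to b + 1.
    visitTerm childTerm : ℕ → ℕ → ℕ → Carrier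
    visitTerm x y b = ((x C b) ℕ.* (y C b)) · ((- r) ^ (y ∸ b) * r ^ (x ∸ b) * t ^ (2 ℕ.* b))
    childTerm x y b =
      ((suc x C suc b) ℕ.* (y C b)) · ((- r) ^ (y ∸ b) * r ^ (x ∸ b) * t ^ (2 ℕ.* suc b))

    private
      ⟦_⟧ : ℕ → Carrier
      ⟦ n ⟧ = n · 1#

      ·-as-* : ∀ n x → n · x ≈ ⟦ n ⟧ * x
      ·-as-* n x = ≈-sym (≈-trans (×-assoc-* n 1# x) (×-congʳ n (*-identityˡ x)))

      *·-as-* : ∀ m n x → (m ℕ.* n) · x ≈ ⟦ m ⟧ * (⟦ n ⟧ * x)
      *·-as-* m n x = ≈-trans (≈-sym (×-assocˡ x m n))
        (≈-trans (·-as-* m _) (*-congˡ (·-as-* n x)))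

      pascal : ∀ n b → ⟦ suc n C suc b ⟧ ≈ ⟦ n C b ⟧ + ⟦ n C suc b ⟧
      pascal n b = ≈-trans (×-congˡ (≡.sym (nCk+nC[k+1]≡[n+1]C[k+1] n b)))
                           (×-homo-+ 1# (n C b) (n C suc b))

      -- Truncation of n ∸ suc b is harmless, as n C suc b then vanishes.
      binom-^ : ∀ a n b → ⟦ n C suc b ⟧ * a ^ (n ∸ b) ≈ ⟦ n C suc b ⟧ * (a * a ^ (n ∸ suc b))
      binom-^ a n b with ℕₚ.<-≤-connex b n
      ... | inj₁ (s≤s b≤m) = reflexive (cong (λ e → ⟦ n C suc b ⟧ * a ^ e) (ℕₚ.+-∸-assoc 1 b≤m))
      ... | inj₂ n≤b = ≈-trans (zero-coef _) (≈-sym (zero-coef _))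
        where
        zero-coef : ∀ x → ⟦ n C suc b ⟧ * x ≈ 0#
        zero-coef x = ≈-trans (*-congʳ (×-congˡ (k>n⇒nCk≡0 (s≤s n≤b)))) (zeroˡ x)

      t^2[1+b] : ∀ b → t ^ (2 ℕ.* suc b) ≈ t * (t * t ^ (2 ℕ.* b))
      t^2[1+b] b = reflexive (cong (t ^_) (ℕₚ.*-suc 2 b))

    -- Pascal's rule for `suc (suc x) C suc b`: the part `suc x C suc b` keeps b and yields a factor
    -- R, the part `suc x C b` yields T².
    childTerm-suc : ∀ x y b →
      childTerm (suc x) y b ≈ r * childTerm x y b + t * (t * visitTerm (suc x) y b)
    childTerm-suc x y b = begin
      childTerm (suc x) y b
        ≈⟨ *·-as-* (suc (suc x) C suc b) (y C b) _ ⟩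
      ⟦ suc (suc x) C suc b ⟧ * (N * (S * P * t ^ (2 ℕ.* suc b)))
        ≈⟨ *-cong (pascal (suc x) b) (*-congˡ (*-congˡ (t^2[1+b] b))) ⟩
      (K + L) * (N * (S * P * (t * (t * U))))
        ≈⟨ solve 7 (λ k l n s p t u → (k :+ l) :* (n :* (s :* p :* (t :* (t :* u)))) :=
                (l :* p) :* (n :* (s :* (t :* (t :* u)))) :+ t :* (t :* (k :* (n :* (s :* p :* u)))))
             ≈-refl K L N S P t U ⟩
      (L * P) * (N * (S * (t * (t * U)))) + t * (t * (K * (N * (S * P * U))))
        ≈⟨ +-congʳ (*-cong (binom-^ r (suc x) b) (*-congˡ (*-congˡ (≈-sym (t^2[1+b] b))))) ⟩
      (L * (r * r ^ (x ∸ b))) * (N * (S * t ^ (2 ℕ.* suc b))) + t * (t * (K * (N * (S * P * U))))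
        ≈⟨ +-congʳ (solve 6 (λ l r p n s u →
             (l :* (r :* p)) :* (n :* (s :* u)) := r :* (l :* (n :* (s :* p :* u))))
             ≈-refl L r (r ^ (x ∸ b)) N S (t ^ (2 ℕ.* suc b))) ⟩
      r * (L * (N * (S * r ^ (x ∸ b) * t ^ (2 ℕ.* suc b)))) + t * (t * (K * (N * (S * P * U))))
        ≈⟨ +-cong (*-congˡ (≈-sym (*·-as-* (suc x C suc b) (y C b) _)))
                  (*-congˡ (*-congˡ (≈-sym (*·-as-* (suc x C b) (y C b) _)))) ⟩
      r * childTerm x y b + t * (t * visitTerm (suc x) y b) ∎
      where
      K = ⟦ suc x C b ⟧
      L = ⟦ suc x C suc b ⟧
      N = ⟦ y C b ⟧
      S = (- r) ^ (y ∸ b)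
      P = r ^ (suc x ∸ b)
      U = t ^ (2 ℕ.* b)

    visitTerm-suc-0 : ∀ x y → visitTerm x (suc y) 0 ≈ - r * visitTerm x y 0
    visitTerm-suc-0 x y = begin
      1 · (- r * (- r) ^ y * r ^ x * 1#)
        ≈⟨ ×-congʳ 1 (solve 3 (λ r s x → r :* s :* x :* con 1 := r :* (s :* x :* con 1))
             ≈-refl _ _ _) ⟩
      1 · (- r * ((- r) ^ y * r ^ x * 1#))
        ≈⟨ ≈-sym (×-comm-* 1 (- r) _) ⟩
      - r * visitTerm x y 0 ∎

    -- Pascal's rule in the other variable, for `suc y C suc b`; the part `y C suc b` yields the
    -- factor -R.
    visitTerm-suc : ∀ x y b →
      visitTerm (suc x) (suc y) (suc b) ≈ childTerm x y b + - r * visitTerm (suc x) y (suc b)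
    visitTerm-suc x y b = begin
      visitTerm (suc x) (suc y) (suc b)
        ≈⟨ *·-as-* (suc x C suc b) (suc y C suc b) _ ⟩
      L * (⟦ suc y C suc b ⟧ * (S * P * U))
        ≈⟨ *-congˡ (*-congʳ (pascal y b)) ⟩
      L * ((M + N) * (S * P * U))
        ≈⟨ solve 6 (λ l m n s p u → l :* ((m :+ n) :* (s :* p :* u)) :=
             l :* (m :* (s :* p :* u)) :+ l :* (n :* s :* (p :* u))) ≈-refl L M N S P U ⟩
      L * (M * (S * P * U)) + L * (N * S * (P * U))
        ≈⟨ +-congˡ (*-congˡ (*-congʳ (binom-^ (- r) y b))) ⟩
      L * (M * (S * P * U)) + L * (N * (- r * (- r) ^ (y ∸ suc b)) * (P * U))
        ≈⟨ +-congˡ (solve 6 (λ l n r s p u → l :* (n :* (r :* s) :* (p :* u)) :=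
             r :* (l :* (n :* (s :* p :* u)))) ≈-refl L N (- r) ((- r) ^ (y ∸ suc b)) P U) ⟩
      L * (M * (S * P * U)) + - r * (L * (N * ((- r) ^ (y ∸ suc b) * P * U)))
        ≈⟨ +-cong (≈-sym (*·-as-* (suc x C suc b) (y C b) _))
                  (*-congˡ (≈-sym (*·-as-* (suc x C suc b) (y C suc b) _))) ⟩
      childTerm x y b + - r * visitTerm (suc x) y (suc b) ∎
      where
      L = ⟦ suc x C suc b ⟧
      M = ⟦ y C b ⟧
      N = ⟦ y C suc b ⟧
      S = (- r) ^ (y ∸ b)
      P = r ^ (x ∸ b)
      U = t ^ (2 ℕ.* suc b)

    childTerm-0 : ∀ y b → childTerm 0 y b ≈ t * (t * visitTerm 0 y b)
    childTerm-0 y (suc b) = ≈-sym (≈-trans (*-congˡ (zeroʳ t)) (zeroʳ t))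
    childTerm-0 y zero    = solve 2 (λ a t →
      a :* con 1 :* (t :* (t :* con 1)) :+ con 0 :=
      t :* (t :* (a :* con 1 :* con 1 :+ con 0))) ≈-refl _ t

    visitTerm-0-suc : ∀ y b → visitTerm 0 (suc y) b ≈ - r * visitTerm 0 y b
    visitTerm-0-suc y zero    = visitTerm-suc-0 0 y
    visitTerm-0-suc y (suc b) = ≈-sym (zeroʳ (- r))

    visitTerm-suc-∑< : ∀ x y n →
      ∑< (suc n) (visitTerm (suc x) (suc y)) ≈
      ∑< n (childTerm x y) + - r * ∑< (suc n) (visitTerm (suc x) y)
    visitTerm-suc-∑< x y n = begin
      visitTerm (suc x) (suc y) 0 + ∑< n (visitTerm (suc x) (suc y) ∘ suc)
        ≈⟨ +-cong (visitTerm-suc-0 (suc x) y) (∑<-cong n (visitTerm-suc x y)) ⟩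
      - r * visitTerm (suc x) y 0 + ∑< n (λ b → childTerm x y b + - r * visitTerm (suc x) y (suc b))
        ≈⟨ +-congˡ (≈-trans (∑<-+ n _ _) (+-congˡ (∑<-* n (- r) _))) ⟩
      - r * visitTerm (suc x) y 0 + (∑< n (childTerm x y) + - r * ∑< n (visitTerm (suc x) y ∘ suc))
        ≈⟨ solve 4 (λ r v c w → r :* v :+ (c :+ r :* w) := c :+ r :* (v :+ w)) ≈-refl _ _ _ _ ⟩
      ∑< n (childTerm x y) + - r * ∑< (suc n) (visitTerm (suc x) y) ∎

    -- With no descent from the node left, every arrival from above is reflected.
    levelWeight-0 : ∀ x → levelWeight r t x 0 ≈ r ^ x
    levelWeight-0 zero    = ≈-refl
    levelWeight-0 (suc x) =
      ≈-trans (+-cong (*-congˡ (levelWeight-0 x)) (zeroʳ t)) (+-identityʳ _)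

    mutual
      -- Simultaneous induction with `levelWeight-childTerm` along the recursion for the weights.
      -- The bound `n` may be any number above y, because y C b vanishes for b > y; this lets the
      -- sums for y and `suc y` share a range.
      nodeWeight-visitTerm : ∀ x y {n} → y ℕ.< n →
        nodeWeight r t ↗ x y ≈ t * ∑< n (visitTerm x y)
      nodeWeight-visitTerm x zero {suc n} _ = begin
        t * levelWeight r t x 0 + - r * 0#
          ≈⟨ +-cong (*-congˡ (levelWeight-0 x)) (zeroʳ _) ⟩
        t * r ^ x + 0#
          ≈⟨ solve 2 (λ t p →
               t :* p :+ con 0 := t :* ((con 1 :* p :* con 1 :+ con 0) :+ con 0))
               ≈-refl t (r ^ x) ⟩
        t * (visitTerm x 0 0 + 0#)
          ≈⟨ *-congˡ (+-congˡ (≈-sym (∑<-0 n λ b → ×-congˡ (ℕₚ.*-zeroʳ (x C suc b))))) ⟩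
        t * ∑< (suc n) (visitTerm x 0) ∎
      nodeWeight-visitTerm zero (suc y) {n} y<n = begin
        t * 0# + - r * nodeWeight r t ↗ 0 y
          ≈⟨ +-congˡ (*-congˡ (nodeWeight-visitTerm 0 y (ℕₚ.<-trans (ℕₚ.n<1+n y) y<n))) ⟩
        t * 0# + - r * (t * ∑< n (visitTerm 0 y))
          ≈⟨ solve 3 (λ t r e → t :* con 0 :+ r :* (t :* e) := t :* (r :* e)) ≈-refl t (- r) _ ⟩
        t * (- r * ∑< n (visitTerm 0 y))
          ≈⟨ *-congˡ (≈-trans (≈-sym (∑<-* n (- r) _)) (∑<-cong n λ b → ≈-sym (visitTerm-0-suc y b))) ⟩
        t * ∑< n (visitTerm 0 (suc y)) ∎
      nodeWeight-visitTerm (suc x) (suc y) {suc n} (s≤s y<n) = begin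
        t * levelWeight r t (suc x) (suc y) + - r * nodeWeight r t ↗ (suc x) y
          ≈⟨ +-cong (*-congˡ (levelWeight-childTerm x y y<n))
                    (*-congˡ (nodeWeight-visitTerm (suc x) y (ℕₚ.<-trans y<n (ℕₚ.n<1+n n)))) ⟩
        t * ∑< n (childTerm x y) + - r * (t * ∑< (suc n) (visitTerm (suc x) y))
          ≈⟨ solve 4 (λ t c r e → t :* c :+ r :* (t :* e) := t :* (c :+ r :* e)) ≈-refl t _ (- r) _ ⟩
        t * (∑< n (childTerm x y) + - r * ∑< (suc n) (visitTerm (suc x) y))
          ≈⟨ *-congˡ (≈-sym (visitTerm-suc-∑< x y n)) ⟩
        t * ∑< (suc n) (visitTerm (suc x) (suc y)) ∎

      levelWeight-childTerm : ∀ x y {n} → y ℕ.< n →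
        levelWeight r t (suc x) (suc y) ≈ ∑< n (childTerm x y)
      levelWeight-childTerm zero y {n} y<n = begin
        r * 0# + t * nodeWeight r t ↗ 0 y
          ≈⟨ +-cong (zeroʳ r) (*-congˡ (nodeWeight-visitTerm 0 y y<n)) ⟩
        0# + t * (t * ∑< n (visitTerm 0 y))
          ≈⟨ +-identityˡ _ ⟩
        t * (t * ∑< n (visitTerm 0 y))
          ≈⟨ *-congˡ (≈-sym (∑<-* n t _)) ⟩
        t * ∑< n (λ b → t * visitTerm 0 y b)
          ≈⟨ ≈-sym (∑<-* n t _) ⟩
        ∑< n (λ b → t * (t * visitTerm 0 y b))
          ≈⟨ ∑<-cong n (λ b → ≈-sym (childTerm-0 y b)) ⟩
        ∑< n (childTerm 0 y) ∎
      levelWeight-childTerm (suc x) y {n} y<n = begin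
        r * levelWeight r t (suc x) (suc y) + t * nodeWeight r t ↗ (suc x) y
          ≈⟨ +-cong (*-congˡ (levelWeight-childTerm x y y<n))
                    (*-congˡ (nodeWeight-visitTerm (suc x) y y<n)) ⟩
        r * ∑< n (childTerm x y) + t * (t * ∑< n (visitTerm (suc x) y))
          ≈⟨ ≈-sym (+-cong (∑<-* n r _) (≈-trans (∑<-* n t _) (*-congˡ (∑<-* n t _)))) ⟩
        ∑< n (λ b → r * childTerm x y b) + ∑< n (λ b → t * (t * visitTerm (suc x) y b))
          ≈⟨ ≈-sym (∑<-+ n _ _) ⟩
        ∑< n (λ b → r * childTerm x y b + t * (t * visitTerm (suc x) y b))
          ≈⟨ ∑<-cong n (λ b → ≈-sym (childTerm-suc x y b)) ⟩
        ∑< n (childTerm (suc x) y) ∎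

    levelTerm : ℕ → ℕ → ℕ → Carrier
    levelTerm x y b = ((x C b) ℕ.* ((y ∸ 1 ℕ.⊓ y) C (b ∸ 1 ℕ.⊓ y))) ·
      ((- r) ^ (y ∸ b) * r ^ (x ∸ b) * t ^ (2 ℕ.* b))

    -- The minimum in u splits the cases. For y = 0 the only index is b = 0; for positive x and y
    -- the range starts at 1, and shifting it gives `childTerm`.
    ∑-levelTerm : ∀ x y → ∑ (interval (1 ℕ.⊓ y) (x ℕ.⊓ y)) (levelTerm x y) ≈ levelWeight r t x y
    ∑-levelTerm x zero rewrite ℕₚ.⊓-zeroʳ x = begin
      1 · (1# * r ^ x * 1#) + 0#
        ≈⟨ solve 1 (λ p → (con 1 :* p :* con 1 :+ con 0) :+ con 0 := p) ≈-refl _ ⟩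
      r ^ x
        ≈⟨ ≈-sym (levelWeight-0 x) ⟩
      levelWeight r t x 0 ∎
    -- The range from 1 to 0 is empty, and the level weight is 0 as well.
    ∑-levelTerm zero    (suc y) = ≈-refl
    ∑-levelTerm (suc x) (suc y) = begin
      ∑ (interval 1 (suc (x ℕ.⊓ y))) (levelTerm (suc x) (suc y))
        ≡⟨ ∑-applyUpTo suc id (suc (x ℕ.⊓ y)) _ ⟩
      ∑< (suc (x ℕ.⊓ y)) (childTerm x y)
        -- Beyond the minimum one of the two binomial coefficients vanishes, so the range can be
        -- extended to all b ≤ y.
        ≈⟨ ∑<-extend (childTerm x y) (s≤s (ℕₚ.m⊓n≤n x y)) vanish ⟩
      ∑< (suc y) (childTerm x y)
        ≈⟨ ≈-sym (levelWeight-childTerm x y (ℕₚ.n<1+n y)) ⟩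
      levelWeight r t (suc x) (suc y) ∎
      where
      vanish : ∀ i → suc (x ℕ.⊓ y) ℕ.≤ i → childTerm x y i ≈ 0#
      vanish i <i with ℕₚ.⊓-sel x y
      ... | inj₁ eq = ×-congˡ {_} (cong (ℕ._* (y C i)) (k>n⇒nCk≡0 (s≤s (subst (ℕ._< i) eq <i))))
      ... | inj₂ eq = ×-congˡ {_} (≡.trans
        (cong ((suc x C suc i) ℕ.*_) (k>n⇒nCk≡0 (subst (ℕ._< i) eq <i))) (ℕₚ.*-zeroʳ (suc x C suc i)))

  -- Factorisation of the amplitude over the levels

  private
    regroup : ∀ m n p q a A b B e E →
      ((m ℕ.* n) ℕ.* (p ℕ.* q)) · ((a * A) * (b * B) * (e * E)) ≈
      ((m ℕ.* p) · (a * b * e)) * ((n ℕ.* q) · (A * B * E))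
    regroup m n p q a A b B e E = begin
      ((m ℕ.* n) ℕ.* (p ℕ.* q)) · ((a * A) * (b * B) * (e * E))
        ≈⟨ ×-congˡ (ℕₚ.[m*n]*[o*p]≡[m*o]*[n*p] m n p q) ⟩
      ((m ℕ.* p) ℕ.* (n ℕ.* q)) · ((a * A) * (b * B) * (e * E))
        ≈⟨ ×-congʳ ((m ℕ.* p) ℕ.* (n ℕ.* q)) (solve 6 (λ a A b B e E →
             (a :* A) :* (b :* B) :* (e :* E) := (a :* b :* e) :* (A :* B :* E))
             ≈-refl a A b B e E) ⟩
      ((m ℕ.* p) ℕ.* (n ℕ.* q)) · ((a * b * e) * (A * B * E))
        ≈⟨ ≈-sym (×-assocˡ _ (m ℕ.* p) (n ℕ.* q)) ⟩
      (m ℕ.* p) · ((n ℕ.* q) · ((a * b * e) * (A * B * E)))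
        ≈⟨ ×-congʳ (m ℕ.* p) (≈-sym (×-comm-* (n ℕ.* q) _ _)) ⟩
      (m ℕ.* p) · ((a * b * e) * ((n ℕ.* q) · (A * B * E)))
        ≈⟨ ≈-sym (×-assoc-* (m ℕ.* p) _ _) ⟩
      ((m ℕ.* p) · (a * b * e)) * ((n ℕ.* q) · (A * B * E)) ∎

  -- V(k) is a box and each summand is a product over the levels, so the sum of products is a
  -- product of sums. `regroup` splits the first level off a summand.
  amplitude-forestWeight : ∀ {M} (R T : Vec Carrier (suc M)) k → amplitude R T k ≈ forestWeight R T k
  amplitude-forestWeight (r ∷ []) (t ∷ []) (x ∷ []) = ≈-trans
    (∑-product _∷_ (interval 0 (x ℕ.⊓ 0)) ([] ∷ []) {levelTerm r t x 0} {λ _ → 1 · (1# * 1# * 1#)}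
      λ { b [] → regroup (x C b) 1 (0 C b) 1 _ _ _ _ _ _ })
    (*-cong (∑-levelTerm r t x 0)
      (solve 0 ((con 1 :* con 1 :* con 1 :+ con 0) :+ con 0 := con 1) ≈-refl))
  amplitude-forestWeight (r ∷ r′ ∷ R) (t ∷ t′ ∷ T) (x ∷ y ∷ k) = ≈-trans
    (∑-product _∷_ (interval (1 ℕ.⊓ y) (x ℕ.⊓ y)) (V (y ∷ k)) {levelTerm r t x y}
      λ b bs → regroup (x C b) _ ((y ∸ 1 ℕ.⊓ y) C (b ∸ 1 ℕ.⊓ y)) _ _ _ _ _ _ _)
    (*-cong (∑-levelTerm r t x y) (amplitude-forestWeight (r′ ∷ R) (t′ ∷ T) (y ∷ k)))

  -- Restriction to 𝔏

  ∑-filter : ∀ {P : I → Set} (P? : ∀ x → Dec (P x)) xs {f} →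
             (∀ {x} → x ∈ xs → ¬ P x → f x ≈ 0#) →
             ∑ (List.filter P? xs) f ≈ ∑ xs f
  ∑-filter P? []       f≈0 = ≈-refl
  ∑-filter P? (x ∷ xs) f≈0 with P? x
  ... | yes _  = +-congˡ (∑-filter P? xs (f≈0 ∘ there))
  ... | no ¬Px = ≈-trans (∑-filter P? xs (f≈0 ∘ there))
    (≈-trans (≈-sym (+-identityˡ _)) (+-congʳ (≈-sym (f≈0 (here refl) ¬Px))))

  Is𝔏? : ∀ {M} (k : Vec ℕ (suc M)) → Dec (Is𝔏 k)
  Is𝔏? k = (lookup k zero ℕₚ.≟ 1) ×-dec
    Finₚ.all? λ n → (lookup k (inject₁ n) ℕₚ.≟ 0) →-dec (lookup k (suc n) ℕₚ.≟ 0)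

  forestWeight-gap : ∀ {M} (R T : Vec Carrier (suc M)) k →
    (∀ (n : Fin M) → lookup k (inject₁ n) ≡ 0 → lookup k (suc n) ≡ 0) ⊎ forestWeight R T k ≈ 0#
  forestWeight-gap (r ∷ [])     (t ∷ [])     (x ∷ [])           = inj₁ λ ()
  forestWeight-gap (r ∷ r′ ∷ R) (t ∷ t′ ∷ T) (zero ∷ suc y ∷ k) = inj₂ (zeroˡ _)
  forestWeight-gap (r ∷ r′ ∷ R) (t ∷ t′ ∷ T) (zero ∷ zero ∷ k)  = Sum.map
    (λ { h zero _ → refl ; h (suc n) → h n }) (λ ≈0 → ≈-trans (*-congˡ ≈0) (zeroʳ _))
    (forestWeight-gap (r′ ∷ R) (t′ ∷ T) (zero ∷ k))
  forestWeight-gap (r ∷ r′ ∷ R) (t ∷ t′ ∷ T) (suc x ∷ y ∷ k)    = Sum.map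
    (λ { h zero () ; h (suc n) → h n }) (λ ≈0 → ≈-trans (*-congˡ ≈0) (zeroʳ _))
    (forestWeight-gap (r′ ∷ R) (t′ ∷ T) (y ∷ k))

  forestWeight-∉𝔏 : ∀ {M} (R T : Vec Carrier (suc M)) k → ¬ Is𝔏 (1 ∷ k) →
                    forestWeight R T (1 ∷ k) ≈ 0#
  forestWeight-∉𝔏 R T k ∉𝔏 with forestWeight-gap R T (1 ∷ k)
  ... | inj₁ h  = contradiction (refl , h) ∉𝔏
  ... | inj₂ ≈0 = ≈0

  -- Arrival times

  halves : ∀ x → x * ½ + x * ½ ≈ x
  halves x = ≈-trans (≈-sym (distribˡ x ½ ½)) (≈-trans (*-congˡ ½+½≈1) (*-identityʳ x))

  climbTime : ∀ {n} → Vec Carrier n → Fin n → Carrier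
  climbTime (t ∷ τ) zero    = t * ½
  climbTime (t ∷ τ) (suc i) = t * ½ + climbTime τ i

  climbTime-suc : ∀ {n} (τ : Vec Carrier n) {i j} → suc (toℕ i) ≡ toℕ j →
                  climbTime τ j ≈ lookup τ j * ½ + climbTime τ i
  climbTime-suc (t ∷ t′ ∷ τ) {zero}  {suc zero} _  = +-comm _ _
  climbTime-suc (t ∷ τ)      {suc i} {suc j}    eq = ≈-trans
    (+-congˡ (climbTime-suc τ (ℕₚ.suc-injective eq)))
    (solve 3 (λ a b x → a :+ (b :+ x) := b :+ (a :+ x)) ≈-refl _ _ _)

  ⟨⟩-Descent : ∀ {n} (τ : Vec Carrier n) {i j k k′} → Descent i k j k′ →
               ⟨ k , τ ⟩ ≈ lookup τ j + ⟨ k′ , τ ⟩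
  ⟨⟩-Descent (t ∷ t′ ∷ τ) here      =
    solve 4 (λ a t b x → a :+ ((t :+ b) :+ x) := t :+ (a :+ (b :+ x))) ≈-refl _ _ _ _
  ⟨⟩-Descent (t ∷ τ)      (there d) = ≈-trans (+-congˡ (⟨⟩-Descent τ d))
    (solve 3 (λ a b x → a :+ (b :+ x) := b :+ (a :+ x)) ≈-refl _ _ _)

  ⟨0⟩ : ∀ {n} (τ : Vec Carrier n) → ⟨ replicate n 0 , τ ⟩ ≈ 0#
  ⟨0⟩ []      = ≈-refl
  ⟨0⟩ (t ∷ τ) = ≈-trans (+-identityˡ _) (⟨0⟩ τ)

  layer-up : ∀ {M} {i j : Fin (suc M)} → suc (toℕ j) ≡ toℕ i → layer (suc i) (suc j) ≡ i
  layer-up {i = i} {j} eq with toℕ i ℕ.≤ᵇ toℕ j | ℕₚ.≤ᵇ⇒≤ (toℕ i) (toℕ j)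
  ... | true  | i≤j = contradiction (i≤j tt) (ℕₚ.<⇒≱ (ℕₚ.≤-reflexive eq))
  ... | false | _   = refl

  layer-down : ∀ {M} {i j : Fin (suc M)} → suc (toℕ i) ≡ toℕ j → layer (suc i) (suc j) ≡ j
  layer-down {i = i} {j} eq
    with toℕ i ℕ.≤ᵇ toℕ j | ℕₚ.≤⇒≤ᵇ (ℕₚ.<⇒≤ (ℕₚ.≤-reflexive eq))
  ... | true | _ = refl

  Walk-time : ∀ {M} (τ : Vec Carrier (suc M)) {i k p} → Walk i k p →
              arrivalTime τ (suc i ∷ p) ≈ ⟨ k , τ ⟩ + climbTime τ i
  Walk-time τ@(_ ∷ _) {zero} (stop _ refl) =
    ≈-trans (+-comm _ 0#) (+-congʳ (≈-sym (⟨0⟩ τ)))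
  Walk-time τ {i} {k} (up {j = j} {p = p} eq w) = begin
    lookup τ (layer (suc i) (suc j)) * ½ + arrivalTime τ (suc j ∷ p)
      ≈⟨ +-cong (*-congʳ (reflexive (cong (lookup τ) (layer-up eq)))) (Walk-time τ w) ⟩
    lookup τ i * ½ + (⟨ k , τ ⟩ + climbTime τ j)
      ≈⟨ solve 3 (λ a b c → a :+ (b :+ c) := b :+ (a :+ c)) ≈-refl _ _ _ ⟩
    ⟨ k , τ ⟩ + (lookup τ i * ½ + climbTime τ j)
      ≈⟨ +-congˡ (≈-sym (climbTime-suc τ eq)) ⟩
    ⟨ k , τ ⟩ + climbTime τ i ∎
  Walk-time τ {i} {k} (down {j = j} {k′ = k′} {p = p} d w) = begin
    lookup τ (layer (suc i) (suc j)) * ½ + arrivalTime τ (suc j ∷ p)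
      ≈⟨ +-cong (*-congʳ (reflexive (cong (lookup τ) (layer-down (Descent-toℕ d))))) (Walk-time τ w) ⟩
    lookup τ j * ½ + (⟨ k′ , τ ⟩ + climbTime τ j)
      ≈⟨ +-congˡ (+-congˡ (climbTime-suc τ (Descent-toℕ d))) ⟩
    lookup τ j * ½ + (⟨ k′ , τ ⟩ + (lookup τ j * ½ + climbTime τ i))
      ≈⟨ solve 3 (λ h b c → h :+ (b :+ (h :+ c)) := ((h :+ h) :+ b) :+ c) ≈-refl _ _ _ ⟩
    ((lookup τ j * ½ + lookup τ j * ½) + ⟨ k′ , τ ⟩) + climbTime τ i
      ≈⟨ +-congʳ (≈-trans (+-congʳ (halves _)) (≈-sym (⟨⟩-Descent τ d))) ⟩
    ⟨ k , τ ⟩ + climbTime τ i ∎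

  -- The initial crossing of layer 0 and the final climb from z_0 make up one two-way time τ_0,
  -- which is the entry k_0 = 1.
  scattering-time : ∀ {M} (τ : Vec Carrier (suc M)) {k q} → Walk zero (0 ∷ k) q →
                    arrivalTime τ (zero ∷ suc zero ∷ q) ≈ ⟨ 1 ∷ k , τ ⟩
  scattering-time (t ∷ τ) {k} {q} w = begin
    t * ½ + arrivalTime (t ∷ τ) (suc zero ∷ q)
      ≈⟨ +-congˡ (Walk-time (t ∷ τ) w) ⟩
    t * ½ + ((0# + ⟨ k , τ ⟩) + t * ½)
      ≈⟨ solve 2 (λ h a → h :+ ((con 0 :+ a) :+ h) := ((h :+ h) :+ con 0) :+ a) ≈-refl _ _ ⟩
    ((t * ½ + t * ½) + 0#) + ⟨ k , τ ⟩
      ≈⟨ +-congʳ (+-congʳ (halves t)) ⟩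
    (t + 0#) + ⟨ k , τ ⟩ ∎

  -- Finitely many counts before a given time

  <-+-pos : ∀ {a b p} → 0# < p → a < b → a < b + p
  <-+-pos {b = b} 0<p a<b = <-trans a<b (<-respˡ-≈ (+-identityʳ b) (+-monoʳ-< b 0<p))

  <-+-· : ∀ {a b p} n → 0# < p → a < b → a < b + n · p
  <-+-· zero    0<p a<b = <-respʳ-≈ (≈-sym (+-identityʳ _)) a<b
  <-+-· (suc n) 0<p a<b = <-respʳ-≈ (+-assoc _ _ _) (<-+-· n 0<p (<-+-pos 0<p a<b))

  <-+-⟨⟩ : ∀ {n a b} (τ : Vec Carrier n) k → (∀ i → 0# < lookup τ i) → a < b → a < b + ⟨ k , τ ⟩
  <-+-⟨⟩ []      []      τ-pos a<b = <-respʳ-≈ (≈-sym (+-identityʳ _)) a<b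
  <-+-⟨⟩ (t ∷ τ) (x ∷ k) τ-pos a<b = <-respʳ-≈ (+-assoc _ _ _)
    (<-+-⟨⟩ τ k (τ-pos ∘ suc) (<-+-· x (τ-pos zero) a<b))

  *-monoˡ-< : ∀ {x y z} → 0# < z → x < y → x * z < y * z
  *-monoˡ-< {x} {y} {z} 0<z x<y = <-respˡ-≈ (+-identityʳ _) (<-respʳ-≈ eq
    (+-monoʳ-< (x * z) (*-pos (<-respˡ-≈ (-‿inverseˡ x) (+-monoʳ-< (- x) x<y)) 0<z)))
    where
    eq : x * z + (- x + y) * z ≈ y * z
    eq = begin
      x * z + (- x + y) * z ≈⟨ ≈-sym (distribʳ z x _) ⟩
      (x + (- x + y)) * z   ≈⟨ *-congʳ (≈-sym (+-assoc x (- x) y)) ⟩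
      ((x + - x) + y) * z   ≈⟨ *-congʳ (≈-trans (+-congʳ (-‿inverseʳ x)) (+-identityˡ y)) ⟩
      y * z ∎

  -- The Archimedean property is applied to `b * t⁻¹`; positivity makes t apart from 0 and therefore
  -- invertible.
  multiple-exceeds : ∀ {t} → 0# < t → ∀ b → ∃[ n ] b < n · t
  multiple-exceeds {t} 0<t b with #⇒invertible (#-sym (<⇒# 0<t))
  ... | t⁻¹ , t⁻¹*[t-0]≈1 , _ with archimedean (b * t⁻¹)
  ...   | n , b/t<n = n , <-respˡ-≈ b/t*t≈b (<-respʳ-≈ n*t≈n·t (*-monoˡ-< 0<t b/t<n))
    where
    b/t*t≈b : b * t⁻¹ * t ≈ b
    b/t*t≈b = begin
      b * t⁻¹ * t          ≈⟨ *-assoc b t⁻¹ t ⟩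
      b * (t⁻¹ * t)        ≈⟨ *-congˡ (*-congˡ (≈-sym (≈-trans (+-congˡ -0#≈0#) (+-identityʳ t)))) ⟩
      b * (t⁻¹ * (t - 0#)) ≈⟨ *-congˡ t⁻¹*[t-0]≈1 ⟩
      b * 1#               ≈⟨ *-identityʳ b ⟩
      b ∎
    n*t≈n·t : (n · 1#) * t ≈ n · t
    n*t≈n·t = ≈-trans (×-assoc-* n 1# t) (×-congʳ n (*-identityˡ t))

  -- A single entry x with x τ_n > b suffices, since the other layers cannot lower the time. The
  -- alternative is decided by comparing natural numbers, so no decision about real inequalities is
  -- needed.
  late-outside-box : ∀ {n} (τ : Vec Carrier n) → (∀ i → 0# < lookup τ i) → ∀ b →
                     ∃[ N ] ∀ k → k ≤ᵛ N ⊎ b < ⟨ k , τ ⟩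
  late-outside-box []      τ-pos b = [] , λ { [] → inj₁ [] }
  late-outside-box (t ∷ τ) τ-pos b
    with multiple-exceeds (τ-pos zero) b | late-outside-box τ (τ-pos ∘ suc) b
  ... | n , b<n·t | N , outside = n ∷ N , go
    where
    go : ∀ k → k ≤ᵛ n ∷ N ⊎ b < ⟨ k , t ∷ τ ⟩
    go (x ∷ k) with ℕₚ.≤-total x n
    ... | inj₂ n≤x = inj₂ (<-+-⟨⟩ τ k (τ-pos ∘ suc) (<-respʳ-≈
      (≈-trans (≈-sym (×-homo-+ t n (x ∸ n))) (×-congˡ (ℕₚ.m+[n∸m]≡n n≤x)))
      (<-+-· (x ∸ n) (τ-pos zero) b<n·t)))
    ... | inj₁ x≤n with outside k
    ...   | inj₁ k≤N = inj₁ (x≤n ∷ k≤N)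
    ...   | inj₂ b<k = inj₂ (<-respʳ-≈ (+-comm _ _) (<-+-· x (τ-pos zero) b<k))

  -- Both sides paired with a test function

  module Pairing {M} (τ R T : Vec Carrier (suc M)) (τ-pos : ∀ n → 0# < lookup τ n)
                 (ψ : TestFunction) where
    open TestFunction ψ

    private
      cutoff  = late-outside-box τ τ-pos bound
      -- The entry k_0 is fixed at 1, so only the bounds on the other entries are kept.
      N       = Vec.tail (proj₁ cutoff)
      ks      = box (replicate M 0) N

    ∈-ks : ∀ k → k ∈ ks ⊎ bound < ⟨ 1 ∷ k , τ ⟩
    ∈-ks k = Sum.map₁ (λ k≤ → Equivalence.from (∈-box⇔ (replicate M 0) N) (0≤ k , tail-≤ k≤))
      (proj₂ cutoff (1 ∷ k))
      where
      0≤ : ∀ {n} (k : Vec ℕ n) → replicate n 0 ≤ᵛ k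
      0≤ []      = []
      0≤ (_ ∷ k) = z≤n ∷ 0≤ k

      tail-≤ : ∀ {n x} {k : Vec ℕ n} {l} → x ∷ k ≤ᵛ l → k ≤ᵛ Vec.tail l
      tail-≤ (_ ∷ k≤l) = k≤l

    -- The sum runs over the whole box rather than its part in 𝔏, which changes nothing because
    -- `forestWeight` vanishes outside 𝔏.
    value : Carrier
    value = ∑ ks λ k → forestWeight R T (1 ∷ k) * φ ⟨ 1 ∷ k , τ ⟩

    vanishes-late : ∀ {a t} → bound < t → a * φ t ≈ 0#
    vanishes-late late = ≈-trans (*-congˡ (vanishes _ (inj₂ late))) (zeroʳ _)

    -- All sequences with the same counts arrive together, so the value of φ factors out and leaves
    -- their total weight.
    ∑-sequences : ∀ k →
      ∑ (sequences k) (λ p → weightOf R T p * φ (arrivalTime τ p)) ≈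
      forestWeight R T (1 ∷ k) * φ ⟨ 1 ∷ k , τ ⟩
    ∑-sequences k = begin
      ∑ (sequences k) (λ p → weightOf R T p * φ (arrivalTime τ p))
        ≈⟨ ∑-cong-∈ (sequences k) same-time ⟩
      ∑ (sequences k) (λ p → weightOf R T p * φ ⟨ 1 ∷ k , τ ⟩)
        ≈⟨ ∑-*ʳ _ (sequences k) (weightOf R T) ⟩
      ∑ (sequences k) (weightOf R T) * φ ⟨ 1 ∷ k , τ ⟩
        ≡⟨ cong (_* _) (∑-map _ (fullWalks zero (0 ∷ k)) _) ⟩
      ∑ (fullWalks zero (0 ∷ k)) (λ q → weightOf R T (zero ∷ suc zero ∷ q)) *
        φ ⟨ 1 ∷ k , τ ⟩
        ≈⟨ *-congʳ (∑-walks R T (steps zero (0 ∷ k)) ↘ zero (0 ∷ k) refl refl ℕₚ.≤-refl) ⟩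
      walkWeight R T ↘ zero (0 ∷ k) * φ ⟨ 1 ∷ k , τ ⟩
        -- The initial crossing of layer 0 brings the walk to z_0 from above: `levelWeight` at 1
        -- unfolds to `nodeWeight` at `↘` and 0.
        ≡⟨ cong (_* _) (walkWeight-forestWeight R T) ⟩
      forestWeight R T (1 ∷ k) * φ ⟨ 1 ∷ k , τ ⟩ ∎
      where
      same-time : ∀ {p} → p ∈ sequences k →
                  weightOf R T p * φ (arrivalTime τ p) ≈ weightOf R T p * φ ⟨ 1 ∷ k , τ ⟩
      same-time p∈ with ∈-sequences⁻ k p∈
      ... | _ , refl , w = *-congˡ (φ-cong (scattering-time τ w))

      walkWeight-forestWeight : ∀ R T → walkWeight R T ↘ zero (0 ∷ k) ≡ forestWeight R T (1 ∷ k)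
      walkWeight-forestWeight (_ ∷ _) (_ ∷ _) = refl

    greensFunction-value : ⟪ greensFunction τ R T , ψ ⟫≈ value
    greensFunction-value = List.concatMap sequences ks , unique , members , outside , sum≈
      where
      unique : Unique (List.concatMap sequences ks)
      unique = Uniqueₚ.concat⁺
        (Allₚ.map⁺ (All.universal sequences-unique ks))
        (AllPairsₚ.map⁺ (AllPairs.map (λ {k} {k′} k≢k′ {p} → sequences-disjoint k k′ k≢k′ {p})
          (box-unique (replicate M 0) N)))

      members : All IsScatteringSequence (List.concatMap sequences ks)
      members = Allₚ.concat⁺ (Allₚ.map⁺ (All.universal (λ k → All.tabulate λ p∈ →
        let _ , p≡ , w = ∈-sequences⁻ k p∈ in
        subst IsScatteringSequence (≡.sym p≡) (Walk⇒scattering w)) ks))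

      outside : ∀ p → IsScatteringSequence p → p ∉ List.concatMap sequences ks →
                weightOf R T p * φ (arrivalTime τ p) ≈ 0#
      outside p p-scat p∉ with scattering⇒Walk p-scat
      ... | k , q , refl , w with ∈-ks k
      ...   | inj₁ k∈ = contradiction
        (∈-concat⁺′ (∈-sequences⁺ w) (∈-map⁺ sequences k∈)) p∉
      ...   | inj₂ late = vanishes-late (<-respʳ-≈ (≈-sym (scattering-time τ w)) late)

      sum≈ = ≈-sym (≈-trans (∑-concatMap sequences ks _) (∑-cong ks ∑-sequences))

    explicitSum-value : ⟪ explicitSum τ R T , ψ ⟫≈ value
    explicitSum-value = List.filter Is𝔏? (List.map (1 ∷_) ks) , unique , members , outside , sum≈
      where
      unique = Uniqueₚ.filter⁺ Is𝔏?
        (Uniqueₚ.map⁺ Vecₚ.∷-injectiveʳ (box-unique (replicate M 0) N))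

      members = Allₚ.all-filter Is𝔏? (List.map (1 ∷_) ks)

      outside : ∀ k → Is𝔏 k → k ∉ List.filter Is𝔏? (List.map (1 ∷_) ks) →
                amplitude R T k * φ ⟨ k , τ ⟩ ≈ 0#
      outside (_ ∷ k) k∈𝔏@(refl , _) k∉ with ∈-ks k
      ... | inj₁ k∈   = contradiction (∈-filter⁺ Is𝔏? (∈-map⁺ (1 ∷_) k∈) k∈𝔏) k∉
      ... | inj₂ late = vanishes-late late

      term : Vec ℕ (suc M) → Carrier
      term k = forestWeight R T k * φ ⟨ k , τ ⟩

      off-𝔏 : ∀ {k} → k ∈ List.map (1 ∷_) ks → ¬ Is𝔏 k → term k ≈ 0#
      off-𝔏 k∈ ∉𝔏 with ∈-map⁻ _ k∈
      ... | k , _ , refl = ≈-trans (*-congʳ (forestWeight-∉𝔏 R T k ∉𝔏)) (zeroˡ _)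

      sum≈ = begin
        ∑ ks (λ k → term (1 ∷ k))
          ≡⟨ ∑-map (1 ∷_) ks term ⟨
        ∑ (List.map (1 ∷_) ks) term
          ≈⟨ ≈-sym (∑-filter Is𝔏? (List.map (1 ∷_) ks) off-𝔏) ⟩
        ∑ (List.filter Is𝔏? (List.map (1 ∷_) ks)) term
          ≈⟨ ∑-cong (List.filter Is𝔏? (List.map (1 ∷_) ks))
               (λ k → *-congʳ (≈-sym (amplitude-forestWeight R T k))) ⟩
        ∑ (List.filter Is𝔏? (List.map (1 ∷_) ks)) (λ k → amplitude R T k * φ ⟨ k , τ ⟩) ∎

theorem1 : ∀ {c ℓ₁ ℓ₂ ℓ₃} (ℝ : RealField c ℓ₁ ℓ₂ ℓ₃) →
    let open RealField ℝ using (Carrier)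
        open Layered ℝ
    in
    (M : ℕ) → 1 ℕ.≤ M →
    (𝓜 : Medium M) →
    let open Medium 𝓜 in
    (T : Vec Carrier (suc M)) → IsTransmission R T →
    greensFunction τ R T ≐ explicitSum τ R T
theorem1 ℝ M _ 𝓜 T _ ψ = value , greensFunction-value , explicitSum-value
  where
  open Layered.Medium 𝓜 using (τ; R; τ-pos)
  open Weights.Pairing ℝ τ R T τ-pos ψ
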